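{- There exist positive integers $c_{i,k}$, for all integers $i\ge 0$ and $i+1\le k\le 2^i$, such that for all $n\ge 1$ \[ b_i(\mathcal{A}_n)=\sum_{k=i+1}^{2^i} c_{i,k}\, S(n+1,k). \] Moreover, $c_{i,k}\le \binom{2^i-1}{k-1}\frac{(k-1)!}{i!}$.
   Context: For $n\ge1$ the resonance arrangement $\mathcal{A}_n$ is the arrangement in $\mathbb{R}^n$ of the hyperplanes $H_I=\{x:\sum_{i\in I}x_i=0\}$ for all nonempty $I\subseteq[n]$. For an arrangement $\mathcal{A}$ in $\mathbb{F}^n$, its characteristic polynomial is $\chi(\mathcal{A};t)=\sum_{S\subseteq\mathcal{A}}(-1)^{|S|}t^{r(\mathcal{A})-r(S)}$, where $r(S)=\operatorname{codim}\bigcap_{H\in S}H$. The $i$-th Betti number $b_i(\mathcal{A})$ is the absolute value of the coefficient of $t^{n-i}$ in $\chi(\mathcal{A};t)$. $S(n,k)$ denotes the Stirling number of the second kind, the number of partitions of an $n$-element set into $k$ nonempty blocks. -}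

module Defs where

open import Data.Bool using (Bool; true; false; if_then_else_)
open import Data.Nat using (ℕ; zero; suc; _+_; _*_; _∸_; _^_; _≤_)
open import Data.Integer as ℤ using (ℤ; +_)
open import Data.Rational as ℚ using (ℚ; 0ℚ; 1ℚ)
open import Data.List as L using (List; []; _∷_; length; map; upTo; _++_)
open import Data.Nat.ListAction using (sum)
open import Data.List.Relation.Unary.All using (All)
open import Data.List.Relation.Binary.Sublist.Propositional using (_⊆_)
open import Data.Vec as V using (Vec; []; _∷_; replicate; zipWith)
open import Data.Product using (Σ; _×_; ∃)
open import Relation.Binary.PropositionalEquality using (_≡_)
open import Relation.Nullary.Decidable using (does)

-- Subsets I ⊆ [n] as characteristic vectors, and the resonance
-- arrangement A_n : one hyperplane H_I = {x : Σ_{i∈I} x_i = 0} for each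
-- nonempty I ⊆ [n], represented by I (equivalently its normal vector).

allSubsets : (n : ℕ) → List (Vec Bool n)
allSubsets zero    = [] ∷ []
allSubsets (suc n) = map (true ∷_) (allSubsets n) ++ map (false ∷_) (allSubsets n)

nonempty : ∀ {n} → Vec Bool n → Bool
nonempty []          = false
nonempty (true ∷ _)  = true
nonempty (false ∷ v) = nonempty v

resonance : (n : ℕ) → List (Vec Bool n)
resonance n = L.filterᵇ nonempty (allSubsets n)

normal : ∀ {n} → Vec Bool n → Vec ℚ n
normal = V.map (λ b → if b then 1ℚ else 0ℚ)

lincomb : ∀ {n} → List ℚ → List (Vec ℚ n) → Vec ℚ n
lincomb (c ∷ cs) (v ∷ vs) = zipWith ℚ._+_ (V.map (c ℚ.*_) v) (lincomb cs vs)
lincomb _        _        = replicate _ 0ℚ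

LinIndep : ∀ {n} → List (Vec ℚ n) → Set
LinIndep {n} vs = ∀ (cs : List ℚ) → length cs ≡ length vs →
  lincomb cs vs ≡ replicate n 0ℚ → All (_≡ 0ℚ) cs

-- r is the rank of vs: the maximal size of a linearly independent
-- sublist (= dim span vs = codim of the intersection of the hyperplanes
-- with these normal vectors).
HasRank : ∀ {n} → List (Vec ℚ n) → ℕ → Set
HasRank vs r =
  (∃ λ ws → ws ⊆ vs × LinIndep ws × length ws ≡ r) ×
  (∀ ws → ws ⊆ vs → LinIndep ws → length ws ≤ r)

IsRankFn : (n : ℕ) → (List (Vec Bool n) → ℕ) → Set
IsRankFn n rk = ∀ S → HasRank (map normal S) (rk S)

sublists : ∀ {a} {A : Set a} → List A → List (List A)
sublists []       = [] ∷ []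
sublists (x ∷ xs) = sublists xs ++ map (x ∷_) (sublists xs)

sumℤ : List ℤ → ℤ
sumℤ = L.foldr ℤ._+_ (+ 0)

sign : ℕ → ℤ
sign zero    = + 1
sign (suc m) = ℤ.- sign m

-- coefficient of t^(n-i) in χ(A_n;t) = Σ_{S ⊆ A_n} (-1)^|S| t^(r(A_n) - r(S)),
-- with exponents compared in ℤ (so no t^(n-i) term exists when i > n).
chiCoeff : (n : ℕ) → (List (Vec Bool n) → ℕ) → ℕ → ℤ
chiCoeff n rk i = sumℤ (map term (sublists (resonance n)))
  where
  term : List (Vec Bool n) → ℤ
  term S = if does ((+ rk (resonance n)) ℤ.- (+ rk S) ℤ.≟ (+ n) ℤ.- (+ i))
             then sign (length S) else + 0

betti : (n : ℕ) → (List (Vec Bool n) → ℕ) → ℕ → ℕ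
betti n rk i = ℤ.∣ chiCoeff n rk i ∣

stirling2 : ℕ → ℕ → ℕ
stirling2 zero    zero    = 1
stirling2 zero    (suc k) = 0
stirling2 (suc n) zero    = 0
stirling2 (suc n) (suc k) = suc k * stirling2 n (suc k) + stirling2 n k

sumFromTo : ℕ → ℕ → (ℕ → ℕ) → ℕ
sumFromTo a b f = sum (map (λ j → f (a + j)) (upTo (suc b ∸ a)))

{-# OPTIONS --safe #-}

-- By Whitney's broken circuit theorem, for the lexicographic order on {0,1}ⁿ, b_i(A_n) is the
-- number of i-element sets of hyperplanes that contain no broken circuit (nbc sets).  Write such
-- a set as an i × n matrix with rows in {0,1}ⁿ.  A vector in the row space is determined by its
-- coefficients, and its entry in a column depends only on that column; hence whether the rows
-- form an nbc set does not change when a zero column, or a column that already occurs further to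
-- the left, is deleted.  A matrix thus amounts to a partition of {0,…,n} (0 marking the zero
-- columns) into k blocks ordered by their minima, together with a matrix with k ∸ 1 distinct
-- nonzero columns, and c i k counts the nbc sets among the latter.  There are
-- ((2 ^ i ∸ 1) C (k ∸ 1)) * (k ∸ 1) ! such matrices, and the i ! orders of the rows give the bound.
-- For positivity, begin with the staircase columns 1⋯1, 01⋯1, …, 0⋯01: a combination of rows
-- that is lexicographically at least each row it involves is then a single row.

module Submission where

open import Defs
open import Algebra.Properties.AbelianGroup using (∙-cancelˡ)
open import Data.Bool as Bool using (Bool; true; false; T; if_then_else_)
open import Data.Fin using (Fin; zero; suc)
open import Data.Integer as ℤ using (ℤ)
import Data.Integer.Properties as ℤ
import Data.Integer.Solver as ℤ-Solver
open import Data.List using (List; []; _∷_; _++_; length; map; filter; upTo)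
open import Data.List.Membership.Propositional using (_∈_; _∉_; lose; find)
open import Data.List.Membership.Propositional.Properties using (∈-map⁺; ∈-map⁻; ∈-++⁺ˡ; ∈-++⁺ʳ; ∈-++⁻; ∈-filter⁺; ∈-filter⁻)
open import Data.List.Properties using (length-map; length-++; map-++; map-∘; map-upTo; map-applyUpTo; ++-identityʳ; filter-all; filter-reject)
open import Data.List.Relation.Binary.Permutation.Propositional using (_↭_; refl; prep; swap; ↭-sym)
open import Data.List.Relation.Binary.Permutation.Propositional.Properties using (∈-resp-↭; ↭-length; map⁺; filter-↭)
open import Data.List.Relation.Binary.Sublist.Propositional as Sublist using (_⊆_; []; _∷ʳ_; _∷_)
open import Data.List.Relation.Unary.All as All using (All; []; _∷_)
import Data.List.Relation.Unary.All.Properties as All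
open import Data.List.Relation.Unary.AllPairs as AllPairs using (AllPairs; []; _∷_)
import Data.List.Relation.Unary.AllPairs.Properties as AllPairs
open import Data.List.Relation.Unary.Any using (Any; here; there; any?)
import Data.List.Relation.Unary.Any.Properties as Any
open import Data.List.Relation.Unary.Unique.Propositional using (Unique)
import Data.List.Relation.Unary.Unique.Propositional.Properties as Unique
open import Data.Nat as ℕ using (ℕ; zero; suc; _+_; _*_; _∸_; _^_; _≤_; _<_; z≤n; s≤s; _!)
import Data.Nat.Properties as ℕ
open import Data.Nat.Combinatorics using (_C_; nCk≡n!/k![n-k]!; [n∸k]!k!∣n!)
open import Data.Nat.Divisibility using (_∣_; quotient; ∣m∣n⇒∣m+n; ∣m+n∣m⇒∣n; m∣m*n; ∣n⇒∣m*n; _∣0)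
open import Data.Nat.DivMod using (m/n*n≡m)
open import Data.Nat.Induction using (<-rec)
open import Data.Nat.ListAction using (sum)
import Data.Nat.Solver as ℕ-Solver
open import Data.Product using (Σ; ∃; _×_; _,_; proj₁; proj₂)
open import Data.Rational as ℚ using (ℚ; 0ℚ; 1ℚ)
import Data.Rational.Properties as ℚ
import Data.Rational.Solver as ℚ-Solver
open import Data.Sum as Sum using (_⊎_; inj₁; inj₂)
open import Data.Unit using (⊤; tt)
open import Data.Vec as Vec using (Vec; []; _∷_; toList; lookup; replicate; zipWith)
import Data.Vec.Properties as Vec
open import Function using (_∘_; flip)
open import Relation.Binary using (DecidableEquality)
open import Relation.Binary.PropositionalEquality using (_≡_; _≢_; refl; sym; trans; cong; cong₂; subst; module ≡-Reasoning)
open import Relation.Nullary using (¬_; Dec; yes; no; does; contradiction; ¬?; _×-dec_)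
open import Relation.Nullary.Decidable using (T?; map′)

-- Linear algebra over ℚ

-- Columns make sense only once the rows are ordered, whereas nbc sets are unordered. So the count
-- runs over `i`-tuples of rows from all of {0,1}ⁿ, zero and repeated rows included: only then does
-- transposing give every word of length n over the alphabet {0,1}ⁱ. Independence is therefore part
-- of `Good`, so that tuples with a zero or a repeated row weigh nothing and the total is `i !`
-- times the Betti number. To divide by `i !`, each `labelled i m` must be a multiple of it. Instead
-- of letting permutations act freely on the rows, the proof uses arithmetic: for every n, the sum
-- of `rStirling n 1 m * labelled i m` over m ≤ n is a multiple of `i !`, and the diagonal entry
-- `rStirling n 1 n` is 1, so divisibility follows by strong induction. The given rank function is
-- known only through `HasRank`; it is replaced by a computed `rank`, which rests on deciding
-- membership in a span. The same decision makes goodness decidable, hence summable as an indicator.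

infixl 6 _⊕_
infixl 7 _⊙_

𝟘 : ∀ {n} → Vec ℚ n
𝟘 = replicate _ 0ℚ

_⊕_ : ∀ {n} → Vec ℚ n → Vec ℚ n → Vec ℚ n
_⊕_ = zipWith ℚ._+_

_⊙_ : ∀ {n} → ℚ → Vec ℚ n → Vec ℚ n
c ⊙ v = Vec.map (c ℚ.*_) v

⊕-identityˡ : ∀ {n} (v : Vec ℚ n) → 𝟘 ⊕ v ≡ v
⊕-identityˡ = Vec.zipWith-identityˡ ℚ.+-identityˡ

⊙-zeroˡ : ∀ {n} (v : Vec ℚ n) → 0ℚ ⊙ v ≡ 𝟘
⊙-zeroˡ []      = refl
⊙-zeroˡ (x ∷ v) = cong₂ _∷_ (ℚ.*-zeroˡ x) (⊙-zeroˡ v)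

⊙-zeroʳ : ∀ {n} c → c ⊙ 𝟘 {n} ≡ 𝟘
⊙-zeroʳ {zero}  c = refl
⊙-zeroʳ {suc n} c = cong₂ _∷_ (ℚ.*-zeroʳ c) (⊙-zeroʳ c)

⊙𝟘-⊕ : ∀ {n} (v y : Vec ℚ n) → 0ℚ ⊙ v ⊕ y ≡ y
⊙𝟘-⊕ v y = trans (cong (_⊕ y) (⊙-zeroˡ v)) (⊕-identityˡ y)

-- Generated inductively, so that inclusions and linear maps are carried through by structural
-- recursion; `Span-∷⁻` recovers the coefficients one generator at a time.
data Span {n} (vs : List (Vec ℚ n)) : Vec ℚ n → Set where
  𝟘∈  : Span vs 𝟘
  gen : ∀ {v} → v ∈ vs → Span vs v
  _⊞_ : ∀ {x y} → Span vs x → Span vs y → Span vs (x ⊕ y)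
  _⊡_ : ∀ c {x} → Span vs x → Span vs (c ⊙ x)

infix 4 _≼_

_≼_ : ∀ {n} → List (Vec ℚ n) → List (Vec ℚ n) → Set
vs ≼ us = ∀ {v} → v ∈ vs → Span us v

Span-mono : ∀ {n} {vs us : List (Vec ℚ n)} → vs ≼ us → ∀ {x} → Span vs x → Span us x
Span-mono vs≼us 𝟘∈      = 𝟘∈
Span-mono vs≼us (gen i) = vs≼us i
Span-mono vs≼us (p ⊞ q) = Span-mono vs≼us p ⊞ Span-mono vs≼us q
Span-mono vs≼us (c ⊡ p) = c ⊡ Span-mono vs≼us p

Span-weaken : ∀ {n} {v} {vs : List (Vec ℚ n)} {x} → Span vs x → Span (v ∷ vs) x
Span-weaken = Span-mono (gen ∘ there)

≼-refl : ∀ {n} {vs : List (Vec ℚ n)} → vs ≼ vs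
≼-refl = gen

≼-trans : ∀ {n} {us vs ws : List (Vec ℚ n)} → us ≼ vs → vs ≼ ws → us ≼ ws
≼-trans p q = Span-mono q ∘ p

∷-≼ : ∀ {n} {v} {vs us : List (Vec ℚ n)} → Span us v → vs ≼ us → v ∷ vs ≼ us
∷-≼ p q (here refl) = p
∷-≼ p q (there i)   = q i

∷-mono-≼ : ∀ {n} {vs us : List (Vec ℚ n)} {v} → vs ≼ us → v ∷ vs ≼ v ∷ us
∷-mono-≼ p = ∷-≼ (gen (here refl)) (Span-weaken ∘ p)

Span-[] : ∀ {n} {x : Vec ℚ n} → Span [] x → x ≡ 𝟘
Span-[] 𝟘∈      = refl
Span-[] (p ⊞ q) = trans (cong₂ _⊕_ (Span-[] p) (Span-[] q)) (⊕-identityˡ 𝟘)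
Span-[] (c ⊡ p) = trans (cong (c ⊙_) (Span-[] p)) (⊙-zeroʳ c)

Span-∷⁻ : ∀ {n} {v} {vs : List (Vec ℚ n)} {x} → Span (v ∷ vs) x →
          ∃ λ c → ∃ λ z → Span vs z × x ≡ c ⊙ v ⊕ z
Span-∷⁻ {v = v} 𝟘∈ = 0ℚ , 𝟘 , 𝟘∈ , sym (⊙𝟘-⊕ v 𝟘)
Span-∷⁻ {v = v} (gen (here refl)) = 1ℚ , 𝟘 , 𝟘∈ , eq v
  where
  eq : ∀ {n} (v : Vec ℚ n) → v ≡ 1ℚ ⊙ v ⊕ 𝟘
  eq []      = refl
  eq (x ∷ v) = cong₂ _∷_ (sym (trans (ℚ.+-identityʳ _) (ℚ.*-identityˡ x))) (eq v)
Span-∷⁻ {v = v} (gen {x} (there i)) = 0ℚ , x , gen i , sym (⊙𝟘-⊕ v x)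
Span-∷⁻ {v = v} (p ⊞ q) with Span-∷⁻ p | Span-∷⁻ q
... | c , y , y∈ , refl | d , z , z∈ , refl = c ℚ.+ d , y ⊕ z , y∈ ⊞ z∈ , eq v y z
  where
  open ℚ-Solver.+-*-Solver
  eq : ∀ {n} (v y z : Vec ℚ n) → (c ⊙ v ⊕ y) ⊕ (d ⊙ v ⊕ z) ≡ (c ℚ.+ d) ⊙ v ⊕ (y ⊕ z)
  eq []      []      []      = refl
  eq (x ∷ v) (y ∷ w) (z ∷ u) = cong₂ _∷_
    (solve 5 (λ c d x y z → (c :* x :+ y) :+ (d :* x :+ z) := (c :+ d) :* x :+ (y :+ z)) refl c d x y z)
    (eq v w u)
Span-∷⁻ {v = v} (a ⊡ p) with Span-∷⁻ p
... | c , y , y∈ , refl = a ℚ.* c , a ⊙ y , a ⊡ y∈ , eq v y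
  where
  open ℚ-Solver.+-*-Solver
  eq : ∀ {n} (v y : Vec ℚ n) → a ⊙ (c ⊙ v ⊕ y) ≡ (a ℚ.* c) ⊙ v ⊕ a ⊙ y
  eq []      []      = refl
  eq (x ∷ v) (y ∷ w) = cong₂ _∷_
    (solve 4 (λ a c x y → a :* (c :* x :+ y) := (a :* c) :* x :+ a :* y) refl a c x y)
    (eq v w)

ℚ-inverse : ∀ {c} → c ≢ 0ℚ → ∃ λ d → d ℚ.* c ≡ 1ℚ
ℚ-inverse {c} c≢0 = ℚ.1/_ c {{nz}} , ℚ.*-inverseˡ c {{nz}}
  where nz = ℚ.≢-nonZero c≢0

-- The coefficient of `v` in `x` is nonzero, for otherwise `x` would lie in the span of `vs`;
-- dividing by it solves for `v`.
Span-exchange : ∀ {n} {v} {vs : List (Vec ℚ n)} {x} →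
                Span (v ∷ vs) x → ¬ Span vs x → Span (x ∷ vs) v
Span-exchange {v = v} {vs} p x∉ with Span-∷⁻ p
... | c , z , z∈ , refl with c ℚ.≟ 0ℚ
...   | yes refl = contradiction (subst (Span vs) (sym (⊙𝟘-⊕ v z)) z∈) x∉
...   | no c≢0   = let d , dc≡1 = ℚ-inverse c≢0 in
  subst (Span _) (eq d dc≡1 v z)
    ((d ⊡ gen (here refl)) ⊞ ((ℚ.- d) ⊡ Span-weaken z∈))
  where
  open ℚ-Solver.+-*-Solver
  eq : ∀ {n} d → d ℚ.* c ≡ 1ℚ → (v z : Vec ℚ n) → d ⊙ (c ⊙ v ⊕ z) ⊕ (ℚ.- d) ⊙ z ≡ v
  eq d dc≡1 []      []      = refl
  eq d dc≡1 (x ∷ v) (z ∷ w) = cong₂ _∷_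
    (trans (solve 4 (λ d c x z → d :* (c :* x :+ z) :+ (:- d) :* z := (d :* c) :* x) refl d c x z)
           (trans (cong (ℚ._* x) dc≡1) (ℚ.*-identityˡ x)))
    (eq d dc≡1 v w)

nonzero-entry : ∀ {n} {v : Vec ℚ n} → v ≢ 𝟘 → ∃ λ j → lookup v j ≢ 0ℚ
nonzero-entry {v = []}    v≢𝟘 = contradiction refl v≢𝟘
nonzero-entry {v = x ∷ v} v≢𝟘 with x ℚ.≟ 0ℚ
... | no x≢0   = zero , x≢0
... | yes refl = let j , p = nonzero-entry (v≢𝟘 ∘ cong (0ℚ ∷_)) in suc j , p

-- Elimination of a nonzero vector v: project along v onto the kernel of a
-- functional φ with φ v = 1, given by a rescaled coordinate where v is nonzero.
module _ {n : ℕ} (v : Vec ℚ n) (v≢𝟘 : v ≢ 𝟘) where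

  private
    j = proj₁ (nonzero-entry v≢𝟘)
    d = proj₁ (ℚ-inverse (proj₂ (nonzero-entry v≢𝟘)))

    φ : Vec ℚ n → ℚ
    φ x = d ℚ.* lookup x j

    π : Vec ℚ n → Vec ℚ n
    π x = (ℚ.- φ x) ⊙ v ⊕ x

    φ-⊕ : ∀ x y → φ (x ⊕ y) ≡ φ x ℚ.+ φ y
    φ-⊕ x y = trans (cong (d ℚ.*_) (Vec.lookup-zipWith ℚ._+_ j x y)) (ℚ.*-distribˡ-+ d _ _)

    φ-⊙ : ∀ c x → φ (c ⊙ x) ≡ c ℚ.* φ x
    φ-⊙ c x = trans (cong (d ℚ.*_) (Vec.lookup-map j (c ℚ.*_) x))
      (solve 3 (λ d c x → d :* (c :* x) := c :* (d :* x)) refl d c (lookup x j))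
      where open ℚ-Solver.+-*-Solver

    π-v : π v ≡ 𝟘
    π-v = trans (cong (λ c → (ℚ.- c) ⊙ v ⊕ v) (proj₂ (ℚ-inverse (proj₂ (nonzero-entry v≢𝟘))))) (eq v)
      where
      eq : ∀ {n} (v : Vec ℚ n) → (ℚ.- 1ℚ) ⊙ v ⊕ v ≡ 𝟘
      eq []      = refl
      eq (x ∷ v) = cong₂ _∷_ (solve 1 (λ x → (:- con 1ℚ) :* x :+ x := con 0ℚ) refl x) (eq v)
        where open ℚ-Solver.+-*-Solver

    π-⊕ : ∀ x y → π (x ⊕ y) ≡ π x ⊕ π y
    π-⊕ x y = trans (cong (λ c → (ℚ.- c) ⊙ v ⊕ (x ⊕ y)) (φ-⊕ x y)) (eq (φ x) (φ y) v x y)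
      where
      eq : ∀ {n} a b (v x y : Vec ℚ n) →
           (ℚ.- (a ℚ.+ b)) ⊙ v ⊕ (x ⊕ y) ≡ ((ℚ.- a) ⊙ v ⊕ x) ⊕ ((ℚ.- b) ⊙ v ⊕ y)
      eq a b [] [] [] = refl
      eq a b (v ∷ vs) (x ∷ xs) (y ∷ ys) = cong₂ _∷_
        (solve 5 (λ a b v x y → (:- (a :+ b)) :* v :+ (x :+ y)
                              := ((:- a) :* v :+ x) :+ ((:- b) :* v :+ y)) refl a b v x y)
        (eq a b vs xs ys)
        where open ℚ-Solver.+-*-Solver

    π-⊙ : ∀ c x → π (c ⊙ x) ≡ c ⊙ π x
    π-⊙ c x = trans (cong (λ e → (ℚ.- e) ⊙ v ⊕ c ⊙ x) (φ-⊙ c x)) (eq (φ x) v x)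
      where
      eq : ∀ {n} a (v x : Vec ℚ n) → (ℚ.- (c ℚ.* a)) ⊙ v ⊕ c ⊙ x ≡ c ⊙ ((ℚ.- a) ⊙ v ⊕ x)
      eq a [] [] = refl
      eq a (v ∷ vs) (x ∷ xs) = cong₂ _∷_
        (solve 4 (λ a c v x → (:- (c :* a)) :* v :+ c :* x := c :* ((:- a) :* v :+ x)) refl a c v x)
        (eq a vs xs)
        where open ℚ-Solver.+-*-Solver

    π-𝟘 : π 𝟘 ≡ 𝟘
    π-𝟘 = trans (cong π (sym (⊙-zeroˡ 𝟘))) (trans (π-⊙ 0ℚ 𝟘) (⊙-zeroˡ (π 𝟘)))

    π-recover : ∀ x → φ x ⊙ v ⊕ π x ≡ x
    π-recover x = eq (φ x) v x
      where
      eq : ∀ {n} a (v x : Vec ℚ n) → a ⊙ v ⊕ ((ℚ.- a) ⊙ v ⊕ x) ≡ x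
      eq a [] [] = refl
      eq a (v ∷ vs) (x ∷ xs) = cong₂ _∷_
        (solve 3 (λ a v x → a :* v :+ ((:- a) :* v :+ x) := x) refl a v x) (eq a vs xs)
        where open ℚ-Solver.+-*-Solver

  eliminate : Vec ℚ n → Vec ℚ n
  eliminate = π

  Span-eliminate⁺ : ∀ {vs x} → Span (v ∷ vs) x → Span (map π vs) (π x)
  Span-eliminate⁺ 𝟘∈ = subst (Span _) (sym π-𝟘) 𝟘∈
  Span-eliminate⁺ (gen (here refl)) = subst (Span _) (sym π-v) 𝟘∈
  Span-eliminate⁺ (gen (there i)) = gen (∈-map⁺ π i)
  Span-eliminate⁺ (_⊞_ {x} {y} p q) =
    subst (Span _) (sym (π-⊕ x y)) (Span-eliminate⁺ p ⊞ Span-eliminate⁺ q)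
  Span-eliminate⁺ (_⊡_ c {x} p) = subst (Span _) (sym (π-⊙ c x)) (c ⊡ Span-eliminate⁺ p)

  map-eliminate-≼ : ∀ vs → map π vs ≼ v ∷ vs
  map-eliminate-≼ (u ∷ vs) (here refl) = ((ℚ.- φ u) ⊡ gen (here refl)) ⊞ gen (there (here refl))
  map-eliminate-≼ (u ∷ vs) (there i) =
    Span-mono (∷-≼ (gen (here refl)) (λ j → gen (there (there j)))) (map-eliminate-≼ vs i)

  Span-eliminate⁻ : ∀ {vs x} → Span (map π vs) (π x) → Span (v ∷ vs) x
  Span-eliminate⁻ {vs} {x} p = subst (Span _) (π-recover x)
    ((φ x ⊡ gen (here refl)) ⊞ Span-mono (map-eliminate-≼ vs) p)

_≟ᵛ_ : ∀ {n} (v w : Vec ℚ n) → Dec (v ≡ w)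
_≟ᵛ_ = Vec.≡-dec ℚ._≟_

-- Gaussian elimination: a zero generator is dropped, a nonzero one is projected away from the other
-- generators and from the target. The recursion is on the length, because the remaining generators
-- change.
span? : ∀ {n} (vs : List (Vec ℚ n)) x → Dec (Span vs x)
span? vs = go (length vs) vs refl
  where
  go : ∀ {n} k (vs : List (Vec ℚ n)) → length vs ≡ k → ∀ x → Dec (Span vs x)
  go k [] _ x = map′ (λ { refl → 𝟘∈ }) Span-[] (x ≟ᵛ 𝟘)
  go (suc k) (v ∷ vs) eq x with v ≟ᵛ 𝟘
  ... | yes refl = map′ Span-weaken (Span-mono (∷-≼ 𝟘∈ ≼-refl)) (go k vs (ℕ.suc-injective eq) x)
  ... | no v≢𝟘   = map′ (Span-eliminate⁻ v v≢𝟘) (Span-eliminate⁺ v v≢𝟘)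
    (go k (map (eliminate v v≢𝟘) vs) (trans (length-map _ vs) (ℕ.suc-injective eq)) _)

-- Independence, bases and rank

Independent : ∀ {n} → List (Vec ℚ n) → Set
Independent []       = ⊤
Independent (v ∷ vs) = ¬ Span vs v × Independent vs

-- One step of the Steinitz exchange. Generators are kept as long as `w` lies in the span of those
-- after them; the first one that `w` needs is traded for `w`. It lies in `vs`, since `w` is not in
-- the span of `us`.
replace-generator : ∀ {n} (vs us : List (Vec ℚ n)) {w} → Span (vs ++ us) w → ¬ Span us w →
                    ∃ λ vs′ → suc (length vs′) ≡ length vs × vs ++ us ≼ vs′ ++ w ∷ us
replace-generator []       us p w∉ = contradiction p w∉
replace-generator (v ∷ vs) us {w} p w∉ with span? (vs ++ us) w
... | yes q = let vs′ , eq , inc = replace-generator vs us q w∉ in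
  v ∷ vs′ , cong suc eq , ∷-mono-≼ inc
... | no w∉′ = vs , refl , ∷-≼ (Span-mono moved (Span-exchange p w∉′)) (moved ∘ there)
  where
  moved : w ∷ vs ++ us ≼ vs ++ w ∷ us
  moved (here refl) = gen (∈-++⁺ʳ vs (here refl))
  moved (there i) with ∈-++⁻ vs i
  ... | inj₁ j = gen (∈-++⁺ˡ j)
  ... | inj₂ j = gen (∈-++⁺ʳ vs (there j))

steinitz : ∀ {n} {vs : List (Vec ℚ n)} ws → Independent ws → ws ≼ vs →
           ∃ λ vs′ → length vs′ + length ws ≡ length vs × vs ≼ vs′ ++ ws
steinitz {vs = vs} [] _ _ = vs , ℕ.+-identityʳ _ , subst (vs ≼_) (sym (++-identityʳ vs)) ≼-refl
steinitz (w ∷ ws) (w∉ , ind) inc with steinitz ws ind (inc ∘ there)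
... | vs′ , eq , inc′ with replace-generator vs′ ws (Span-mono inc′ (inc (here refl))) w∉
...   | vs″ , eq′ , inc″ = vs″ ,
  trans (ℕ.+-suc (length vs″) (length ws)) (trans (cong (_+ length ws) eq′) eq) ,
  ≼-trans inc′ inc″

independent-length : ∀ {n} {vs ws : List (Vec ℚ n)} → Independent ws → ws ≼ vs → length ws ≤ length vs
independent-length {ws = ws} ind inc with steinitz ws ind inc
... | vs′ , eq , _ = subst (length ws ≤_) eq (ℕ.m≤n+m _ (length vs′))

basis : ∀ {n} → List (Vec ℚ n) → List (Vec ℚ n)
basis []       = []
basis (v ∷ vs) with span? vs v
... | yes _ = basis vs
... | no _  = v ∷ basis vs

basis-⊆ : ∀ {n} (vs : List (Vec ℚ n)) → basis vs ⊆ vs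
basis-⊆ []       = []
basis-⊆ (v ∷ vs) with span? vs v
... | yes _ = v ∷ʳ basis-⊆ vs
... | no _  = refl ∷ basis-⊆ vs

basis-≼ : ∀ {n} (vs : List (Vec ℚ n)) → basis vs ≼ vs
basis-≼ vs = gen ∘ Sublist.lookup (basis-⊆ vs)

≼-basis : ∀ {n} (vs : List (Vec ℚ n)) → vs ≼ basis vs
≼-basis (v ∷ vs) with span? vs v
... | yes p = ∷-≼ (Span-mono (≼-basis vs) p) (≼-basis vs)
... | no _  = ∷-mono-≼ (≼-basis vs)

basis-independent : ∀ {n} (vs : List (Vec ℚ n)) → Independent (basis vs)
basis-independent []       = tt
basis-independent (v ∷ vs) with span? vs v
... | yes _ = basis-independent vs
... | no v∉ = v∉ ∘ Span-mono (basis-≼ vs) , basis-independent vs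

rank : ∀ {n} → List (Vec ℚ n) → ℕ
rank vs = length (basis vs)

rank-mono : ∀ {n} {vs us : List (Vec ℚ n)} → vs ≼ us → rank vs ≤ rank us
rank-mono {vs = vs} {us} inc =
  independent-length (basis-independent vs) (≼-trans (basis-≼ vs) (≼-trans inc (≼-basis us)))

rank-cong : ∀ {n} {vs us : List (Vec ℚ n)} → vs ≼ us → us ≼ vs → rank vs ≡ rank us
rank-cong {vs = vs} {us} p q = ℕ.≤-antisym (rank-mono {vs = vs} p) (rank-mono {vs = us} q)

rank-∷-∉ : ∀ {n} {v} {vs : List (Vec ℚ n)} → ¬ Span vs v → rank (v ∷ vs) ≡ suc (rank vs)
rank-∷-∉ {v = v} {vs} v∉ with span? vs v
... | yes p = contradiction p v∉
... | no _  = refl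

rank≤length : ∀ {n} (vs : List (Vec ℚ n)) → rank vs ≤ length vs
rank≤length vs = independent-length (basis-independent vs) (basis-≼ vs)

independent⇒rank≡length : ∀ {n} (vs : List (Vec ℚ n)) → Independent vs → rank vs ≡ length vs
independent⇒rank≡length []       _         = refl
independent⇒rank≡length (v ∷ vs) (v∉ , ind) =
  trans (rank-∷-∉ v∉) (cong suc (independent⇒rank≡length vs ind))

rank≡length⇒independent : ∀ {n} (vs : List (Vec ℚ n)) → rank vs ≡ length vs → Independent vs
rank≡length⇒independent []       _  = tt
rank≡length⇒independent (v ∷ vs) eq with span? vs v
... | yes _ = contradiction (rank≤length vs) (ℕ.<⇒≱ (ℕ.≤-reflexive (sym eq)))
... | no v∉ = v∉ , rank≡length⇒independent vs (ℕ.suc-injective eq)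

lincomb∈Span : ∀ {n} cs (vs : List (Vec ℚ n)) → Span vs (lincomb cs vs)
lincomb∈Span []       []       = 𝟘∈
lincomb∈Span []       (v ∷ vs) = 𝟘∈
lincomb∈Span (c ∷ cs) []       = 𝟘∈
lincomb∈Span (c ∷ cs) (v ∷ vs) = (c ⊡ gen (here refl)) ⊞ Span-weaken (lincomb∈Span cs vs)

Span⇒lincomb : ∀ {n} (vs : List (Vec ℚ n)) {x} → Span vs x →
               ∃ λ cs → length cs ≡ length vs × lincomb cs vs ≡ x
Span⇒lincomb []       p = [] , refl , sym (Span-[] p)
Span⇒lincomb (v ∷ vs) p with Span-∷⁻ p
... | c , z , z∈ , refl with Span⇒lincomb vs z∈
...   | cs , eq , refl = c ∷ cs , cong suc eq , refl

⊕-cancel : ∀ {n} (x : Vec ℚ n) → (ℚ.- 1ℚ) ⊙ x ⊕ x ≡ 𝟘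
⊕-cancel []      = refl
⊕-cancel (x ∷ v) = cong₂ _∷_ (solve 1 (λ x → (:- con 1ℚ) :* x :+ x := con 0ℚ) refl x) (⊕-cancel v)
  where open ℚ-Solver.+-*-Solver

LinIndep⇒independent : ∀ {n} (vs : List (Vec ℚ n)) → LinIndep vs → Independent vs
LinIndep⇒independent []       _  = tt
LinIndep⇒independent (v ∷ vs) li = v∉ , LinIndep⇒independent vs tail
  where
  v∉ : ¬ Span vs v
  v∉ p with Span⇒lincomb vs p
  ... | cs , eq , refl with li (ℚ.- 1ℚ ∷ cs) (cong suc eq) (⊕-cancel v)
  ...   | () ∷ _
  tail : LinIndep vs
  tail cs eq z with li (0ℚ ∷ cs) (cong suc eq) (trans (⊙𝟘-⊕ v _) z)
  ... | _ ∷ zs = zs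

independent⇒LinIndep : ∀ {n} (vs : List (Vec ℚ n)) → Independent vs → LinIndep vs
independent⇒LinIndep []       _          []       _  _ = []
independent⇒LinIndep (v ∷ vs) (v∉ , ind) (c ∷ cs) eq z with c ℚ.≟ 0ℚ
... | yes refl = refl ∷ independent⇒LinIndep vs ind cs (ℕ.suc-injective eq) (trans (sym (⊙𝟘-⊕ v _)) z)
... | no c≢0   = contradiction
  (subst (Span vs) (solve-for v (lincomb cs vs) z) ((ℚ.- d) ⊡ lincomb∈Span cs vs)) v∉
  where
  d = proj₁ (ℚ-inverse c≢0)
  open ℚ-Solver.+-*-Solver
  solve-for : ∀ {n} (v y : Vec ℚ n) → c ⊙ v ⊕ y ≡ 𝟘 → (ℚ.- d) ⊙ y ≡ v
  solve-for []      []      _  = refl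
  solve-for (v ∷ vs) (y ∷ ys) eq = cong₂ _∷_
    (trans (solve 4 (λ d c v y → (:- d) :* y := (d :* c) :* v :- d :* (c :* v :+ y)) refl d c v y)
    (trans (cong₂ (λ a b → a ℚ.* v ℚ.- d ℚ.* b) (proj₂ (ℚ-inverse c≢0)) (cong Vec.head eq))
           (solve 2 (λ d v → con 1ℚ :* v :- d :* con 0ℚ := v) refl d v)))
    (solve-for vs ys (cong Vec.tail eq))

-- Steinitz bounds the length of the given independent sublist by that of the greedy basis; the
-- given maximality, tested on that basis, is the converse.
HasRank⇒rank : ∀ {n} {vs : List (Vec ℚ n)} {r} → HasRank vs r → r ≡ rank vs
HasRank⇒rank {vs = vs} ((ws , ws⊆vs , li , refl) , max) = ℕ.≤-antisym
  (independent-length (LinIndep⇒independent ws li) (≼-basis vs ∘ Sublist.lookup ws⊆vs))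
  (max (basis vs) (basis-⊆ vs) (independent⇒LinIndep _ (basis-independent vs)))

-- Dimension of the ambient space

units : ∀ n → List (Vec ℚ n)
units zero    = []
units (suc n) = (1ℚ ∷ 𝟘) ∷ map (0ℚ ∷_) (units n)

length-units : ∀ n → length (units n) ≡ n
length-units zero    = refl
length-units (suc n) = cong suc (trans (length-map _ (units n)) (length-units n))

Span-map-0∷ : ∀ {n} {vs : List (Vec ℚ n)} {x} → Span vs x → Span (map (0ℚ ∷_) vs) (0ℚ ∷ x)
Span-map-0∷ 𝟘∈      = 𝟘∈
Span-map-0∷ (gen i) = gen (∈-map⁺ _ i)
Span-map-0∷ (p ⊞ q) = Span-map-0∷ p ⊞ Span-map-0∷ q
Span-map-0∷ (_⊡_ c {x} p) = subst (Span _) (cong (_∷ c ⊙ x) (ℚ.*-zeroʳ c)) (c ⊡ Span-map-0∷ p)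

units-span : ∀ {n} (x : Vec ℚ n) → Span (units n) x
units-span []      = 𝟘∈
units-span (a ∷ x) = subst (Span _) eq
  ((a ⊡ gen (here refl)) ⊞ Span-weaken (Span-map-0∷ (units-span x)))
  where
  eq : a ⊙ (1ℚ ∷ 𝟘) ⊕ (0ℚ ∷ x) ≡ a ∷ x
  eq = cong₂ _∷_ (trans (ℚ.+-identityʳ _) (ℚ.*-identityʳ a))
                 (trans (cong (_⊕ x) (⊙-zeroʳ a)) (⊕-identityˡ x))

Span-map-0∷⁻ : ∀ {n} {vs : List (Vec ℚ n)} {x} → Span (map (0ℚ ∷_) vs) x →
               Vec.head x ≡ 0ℚ × Span vs (Vec.tail x)
Span-map-0∷⁻ 𝟘∈ = refl , 𝟘∈
Span-map-0∷⁻ {vs = v ∷ vs} (gen (here refl)) = refl , gen (here refl)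
Span-map-0∷⁻ {vs = v ∷ vs} (gen (there i)) = let eq , p = Span-map-0∷⁻ {vs = vs} (gen i) in
  eq , Span-weaken p
Span-map-0∷⁻ (_⊞_ {a ∷ x} {b ∷ y} p q) with Span-map-0∷⁻ p | Span-map-0∷⁻ q
... | refl , p′ | refl , q′ = refl , p′ ⊞ q′
Span-map-0∷⁻ (_⊡_ c {a ∷ x} p) with Span-map-0∷⁻ p
... | refl , p′ = ℚ.*-zeroʳ c , c ⊡ p′

units-independent : ∀ n → Independent (units n)
units-independent zero    = tt
units-independent (suc n) = (λ p → contradiction (proj₁ (Span-map-0∷⁻ p)) λ ()) , lift (units n) (units-independent n)
  where
  lift : ∀ {n} (vs : List (Vec ℚ n)) → Independent vs → Independent (map (0ℚ ∷_) vs)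
  lift []       _          = tt
  lift (v ∷ vs) (v∉ , ind) = v∉ ∘ proj₂ ∘ Span-map-0∷⁻ , lift vs ind

rank≤dimension : ∀ {n} (vs : List (Vec ℚ n)) → rank vs ≤ n
rank≤dimension {n} vs = subst (rank vs ≤_) (length-units n)
  (independent-length (basis-independent vs) (λ _ → units-span _))

spanning⇒rank≡dimension : ∀ {n} (vs : List (Vec ℚ n)) → units n ≼ vs → rank vs ≡ n
spanning⇒rank≡dimension {n} vs inc = ℕ.≤-antisym (rank≤dimension vs)
  (subst (_≤ rank vs) (length-units n)
    (independent-length (units-independent n) (≼-trans inc (≼-basis vs))))

-- Sums over tuples and sublists

∑ : {A : Set} → List A → (A → ℕ) → ℕ
∑ xs f = sum (map f xs)

∑-cong : {A : Set} {f g : A → ℕ} → (∀ x → f x ≡ g x) → (xs : List A) → ∑ xs f ≡ ∑ xs g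
∑-cong e []       = refl
∑-cong e (x ∷ xs) = cong₂ _+_ (e x) (∑-cong e xs)

∑-mono : {A : Set} {f g : A → ℕ} → (∀ x → f x ≤ g x) → (xs : List A) → ∑ xs f ≤ ∑ xs g
∑-mono e []       = z≤n
∑-mono e (x ∷ xs) = ℕ.+-mono-≤ (e x) (∑-mono e xs)

∑-zero : {A : Set} {f : A → ℕ} → (∀ x → f x ≡ 0) → (xs : List A) → ∑ xs f ≡ 0
∑-zero e []       = refl
∑-zero e (x ∷ xs) = cong₂ _+_ (e x) (∑-zero e xs)

∑-++ : {A : Set} (xs ys : List A) (f : A → ℕ) → ∑ (xs ++ ys) f ≡ ∑ xs f + ∑ ys f
∑-++ []       ys f = refl
∑-++ (x ∷ xs) ys f = trans (cong (f x +_) (∑-++ xs ys f)) (sym (ℕ.+-assoc (f x) _ _))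

∑-map : {A B : Set} (g : A → B) (xs : List A) (f : B → ℕ) → ∑ (map g xs) f ≡ ∑ xs (f ∘ g)
∑-map g []       f = refl
∑-map g (x ∷ xs) f = cong (f (g x) +_) (∑-map g xs f)

∑-+ : {A : Set} (xs : List A) (f g : A → ℕ) → ∑ xs (λ x → f x + g x) ≡ ∑ xs f + ∑ xs g
∑-+ []       f g = refl
∑-+ (x ∷ xs) f g = trans (cong (f x + g x +_) (∑-+ xs f g))
  (solve 4 (λ a b c d → (a :+ b) :+ (c :+ d) := (a :+ c) :+ (b :+ d)) refl (f x) (g x) (∑ xs f) (∑ xs g))
  where open ℕ-Solver.+-*-Solver

∑-*ˡ : {A : Set} (c : ℕ) (xs : List A) (f : A → ℕ) → ∑ xs (λ x → c * f x) ≡ c * ∑ xs f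
∑-*ˡ c []       f = sym (ℕ.*-zeroʳ c)
∑-*ˡ c (x ∷ xs) f = trans (cong (c * f x +_) (∑-*ˡ c xs f)) (sym (ℕ.*-distribˡ-+ c (f x) _))

∑-*ʳ : {A : Set} (c : ℕ) (xs : List A) (f : A → ℕ) → ∑ xs (λ x → f x * c) ≡ ∑ xs f * c
∑-*ʳ c xs f = trans (∑-cong (λ x → ℕ.*-comm (f x) c) xs) (trans (∑-*ˡ c xs f) (ℕ.*-comm c _))

∑-swap : {A B : Set} (xs : List A) (ys : List B) (f : A → B → ℕ) →
         ∑ xs (λ x → ∑ ys (f x)) ≡ ∑ ys (λ y → ∑ xs (λ x → f x y))
∑-swap []       ys f = sym (∑-zero (λ _ → refl) ys)
∑-swap (x ∷ xs) ys f = trans (cong (∑ ys (f x) +_) (∑-swap xs ys f))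
                             (sym (∑-+ ys (f x) (λ y → ∑ xs (λ x → f x y))))

∑-upTo-suc : ∀ n f → ∑ (upTo (suc n)) f ≡ f 0 + ∑ (upTo n) (f ∘ suc)
∑-upTo-suc n f = cong (λ l → f 0 + sum l) (trans (map-applyUpTo suc f n) (sym (map-upTo (f ∘ suc) n)))

∑-upTo-+ : ∀ m n f → ∑ (upTo (m + n)) f ≡ ∑ (upTo m) f + ∑ (upTo n) (λ j → f (m + j))
∑-upTo-+ zero    n f = refl
∑-upTo-+ (suc m) n f = begin
  ∑ (upTo (suc m + n)) f                                              ≡⟨ ∑-upTo-suc (m + n) f ⟩
  f 0 + ∑ (upTo (m + n)) (f ∘ suc)                                    ≡⟨ cong (f 0 +_) (∑-upTo-+ m n (f ∘ suc)) ⟩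
  f 0 + (∑ (upTo m) (f ∘ suc) + ∑ (upTo n) (λ j → f (suc m + j)))     ≡⟨ ℕ.+-assoc (f 0) _ _ ⟨
  f 0 + ∑ (upTo m) (f ∘ suc) + ∑ (upTo n) (λ j → f (suc m + j))       ≡⟨ cong (_+ ∑ (upTo n) (λ j → f (suc m + j))) (∑-upTo-suc m f) ⟨
  ∑ (upTo (suc m)) f + ∑ (upTo n) (λ j → f (suc m + j))               ∎
  where open ≡-Reasoning

∑-upTo-last : ∀ n f → ∑ (upTo (suc n)) f ≡ ∑ (upTo n) f + f n
∑-upTo-last n f = trans (cong (λ k → ∑ (upTo k) f) (ℕ.+-comm 1 n))
  (trans (∑-upTo-+ n 1 f) (cong (∑ (upTo n) f +_) (trans (ℕ.+-identityʳ _) (cong f (ℕ.+-identityʳ n)))))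

∑-upTo-zero : ∀ n {f} → (∀ j → j < n → f j ≡ 0) → ∑ (upTo n) f ≡ 0
∑-upTo-zero zero        h = refl
∑-upTo-zero (suc n) {f} h = trans (∑-upTo-last n f)
  (cong₂ _+_ (∑-upTo-zero n (λ j j<n → h j (ℕ.m<n⇒m<1+n j<n))) (h n (ℕ.n<1+n n)))

𝟙 : {P : Set} → Dec P → ℕ
𝟙 d = if does d then 1 else 0

𝟙-yes : {P : Set} (d : Dec P) → P → 𝟙 d ≡ 1
𝟙-yes (yes _) _ = refl
𝟙-yes (no ¬p) p = contradiction p ¬p

𝟙-no : {P : Set} (d : Dec P) → ¬ P → 𝟙 d ≡ 0
𝟙-no (yes p) ¬p = contradiction p ¬p
𝟙-no (no _)  _  = refl

𝟙-cong : {P Q : Set} (p : Dec P) (q : Dec Q) → (P → Q) → (Q → P) → 𝟙 p ≡ 𝟙 q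
𝟙-cong (yes p) q f g = sym (𝟙-yes q (f p))
𝟙-cong (no ¬p) q f g = sym (𝟙-no q (¬p ∘ g))

𝟙≤1 : {P : Set} (p : Dec P) → 𝟙 p ≤ 1
𝟙≤1 (yes _) = ℕ.≤-refl
𝟙≤1 (no _)  = z≤n

∑-tuples : {A : Set} (i : ℕ) → List A → (Vec A i → ℕ) → ℕ
∑-tuples zero    xs w = w []
∑-tuples (suc i) xs w = ∑ xs λ x → ∑-tuples i xs (w ∘ (x ∷_))

∑-tuples-cong : {A : Set} (i : ℕ) (xs : List A) {w w′ : Vec A i → ℕ} →
                (∀ v → w v ≡ w′ v) → ∑-tuples i xs w ≡ ∑-tuples i xs w′
∑-tuples-cong zero    xs e = e []
∑-tuples-cong (suc i) xs e = ∑-cong (λ x → ∑-tuples-cong i xs (λ v → e (x ∷ v))) xs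

∑-tuples-zero : {A : Set} (i : ℕ) (xs : List A) {w : Vec A i → ℕ} → (∀ v → w v ≡ 0) → ∑-tuples i xs w ≡ 0
∑-tuples-zero zero    xs e = e []
∑-tuples-zero (suc i) xs e = ∑-zero (λ x → ∑-tuples-zero i xs (λ v → e (x ∷ v))) xs

∑-choose : {A : Set} (i : ℕ) → List A → (List A → ℕ) → ℕ
∑-choose i xs w = ∑ (sublists xs) λ S → 𝟙 (length S ℕ.≟ i) * w S

∑-choose-0 : {A : Set} (x : A) (xs : List A) (w : List A → ℕ) → ∑-choose 0 (x ∷ xs) w ≡ ∑-choose 0 xs w
∑-choose-0 x xs w = trans (∑-++ (sublists xs) _ _)
  (trans (cong (∑-choose 0 xs w +_) (trans (∑-map (x ∷_) (sublists xs) _) (∑-zero (λ _ → refl) (sublists xs))))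
         (ℕ.+-identityʳ _))

∑-choose-suc : {A : Set} (i : ℕ) (x : A) (xs : List A) (w : List A → ℕ) →
               ∑-choose (suc i) (x ∷ xs) w ≡ ∑-choose (suc i) xs w + ∑-choose i xs (w ∘ (x ∷_))
∑-choose-suc i x xs w = trans (∑-++ (sublists xs) _ _)
  (cong (∑-choose (suc i) xs w +_) (∑-map (x ∷_) (sublists xs) _))

∑-choose-zero : {A : Set} (i : ℕ) (xs : List A) {w : List A → ℕ} → (∀ S → w S ≡ 0) → ∑-choose i xs w ≡ 0
∑-choose-zero i xs e = ∑-zero (λ S → trans (cong (𝟙 (length S ℕ.≟ i) *_) (e S)) (ℕ.*-zeroʳ (𝟙 (length S ℕ.≟ i)))) (sublists xs)

-- An element outside `P` may stand anywhere in a sublist; the symmetry of `w` brings it to the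
-- front, where `vanish` applies. This is how the empty subset is discarded when passing from
-- `allSubsets` to `resonance`.
∑-choose-filter : {A : Set} {P : A → Set} (P? : ∀ x → Dec (P x)) (i : ℕ) (xs : List A) (w : List A → ℕ) →
                  (∀ {S S′} → S ↭ S′ → w S ≡ w S′) → (∀ x S → ¬ P x → w (x ∷ S) ≡ 0) →
                  ∑-choose i xs w ≡ ∑-choose i (filter P? xs) w
∑-choose-filter P? i       []       w sym-w vanish = refl
∑-choose-filter P? zero    (x ∷ xs) w sym-w vanish with P? x
... | yes _ = trans (∑-choose-0 x xs w) (trans (∑-choose-filter P? 0 xs w sym-w vanish)
                    (sym (∑-choose-0 x (filter P? xs) w)))
... | no _  = trans (∑-choose-0 x xs w) (∑-choose-filter P? 0 xs w sym-w vanish)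
∑-choose-filter P? (suc i) (x ∷ xs) w sym-w vanish with P? x
... | yes _ = trans (∑-choose-suc i x xs w) (trans (cong₂ _+_
    (∑-choose-filter P? (suc i) xs w sym-w vanish)
    (∑-choose-filter P? i xs (w ∘ (x ∷_)) (sym-w ∘ prep x)
      (λ y S ¬py → trans (sym-w (swap x y refl)) (vanish y (x ∷ S) ¬py))))
    (sym (∑-choose-suc i x (filter P? xs) w)))
... | no ¬px = trans (∑-choose-suc i x xs w) (trans (cong₂ _+_
    (∑-choose-filter P? (suc i) xs w sym-w vanish)
    (∑-choose-zero i xs (λ S → vanish x S ¬px)))
    (ℕ.+-identityʳ _))

∑-tuples-skip : {A : Set} (i : ℕ) (x : A) (xs : List A) (w : List A → ℕ) →
                (∀ {S S′} → S ↭ S′ → w S ≡ w S′) → (∀ S → w (x ∷ S) ≡ 0) →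
                ∑-tuples i (x ∷ xs) (w ∘ toList) ≡ ∑-tuples i xs (w ∘ toList)
∑-tuples-skip zero    x xs w sym-w vanish = refl
∑-tuples-skip (suc i) x xs w sym-w vanish = cong₂ _+_
  (∑-tuples-zero i (x ∷ xs) (λ v → vanish (toList v)))
  (∑-cong (λ y → ∑-tuples-skip i x xs (w ∘ (y ∷_)) (sym-w ∘ prep y)
                   (λ S → trans (sym-w (swap y x refl)) (vanish (y ∷ S)))) xs)

-- A tuple without repetitions contains the head x at most once, at one of suc i positions.
∑-tuples-∷ : {A : Set} (i : ℕ) (x : A) (xs : List A) (w : List A → ℕ) →
             (∀ {S S′} → S ↭ S′ → w S ≡ w S′) → (∀ y S → w (y ∷ y ∷ S) ≡ 0) →
             ∑-tuples (suc i) (x ∷ xs) (w ∘ toList) ≡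
             ∑-tuples (suc i) xs (w ∘ toList) + suc i * ∑-tuples i xs (w ∘ (x ∷_) ∘ toList)
∑-tuples-∷ zero x xs w sym-w vanish =
  trans (ℕ.+-comm (w (x ∷ [])) _) (cong (∑ xs (λ y → w (y ∷ [])) +_) (sym (ℕ.+-identityʳ _)))
∑-tuples-∷ (suc i) x xs w sym-w vanish = begin
  ∑-tuples (suc i) (x ∷ xs) (w ∘ (x ∷_) ∘ toList) +
    ∑ xs (λ y → ∑-tuples (suc i) (x ∷ xs) (w ∘ (y ∷_) ∘ toList))
      ≡⟨ cong₂ _+_
           (∑-tuples-skip (suc i) x xs (w ∘ (x ∷_)) (sym-w ∘ prep x) (vanish x))
           (∑-cong (λ y → ∑-tuples-∷ i x xs (w ∘ (y ∷_)) (sym-w ∘ prep y)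
             (λ z S → trans (sym-w (move y z)) (vanish z (y ∷ S)))) xs) ⟩
  a + ∑ xs (λ y → ∑-tuples (suc i) xs (w ∘ (y ∷_) ∘ toList) + suc i * ∑-tuples i xs (w ∘ (y ∷_) ∘ (x ∷_) ∘ toList))
      ≡⟨ cong (a +_) (∑-+ xs _ _) ⟩
  a + (b + ∑ xs (λ y → suc i * ∑-tuples i xs (w ∘ (y ∷_) ∘ (x ∷_) ∘ toList)))
      ≡⟨ cong (λ s → a + (b + s)) (trans (∑-*ˡ (suc i) xs _) (cong (suc i *_)
           (∑-cong (λ y → ∑-tuples-cong i xs (λ v → sym-w (swap y x refl))) xs))) ⟩
  a + (b + suc i * a)
      ≡⟨ solve 3 (λ a b c → a :+ (b :+ c) := b :+ (a :+ c)) refl a b (suc i * a) ⟩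
  b + suc (suc i) * a ∎
  where
  open ≡-Reasoning
  open ℕ-Solver.+-*-Solver using (solve; _:+_; _:=_)
  a = ∑-tuples (suc i) xs (w ∘ (x ∷_) ∘ toList)
  b = ∑-tuples (suc (suc i)) xs (w ∘ toList)
  move : ∀ y z {S} → y ∷ z ∷ z ∷ S ↭ z ∷ z ∷ y ∷ S
  move y z = _↭_.trans (swap y z refl) (prep z (swap y z refl))

-- Both sides obey the same recursion in the list: by `∑-tuples-∷` a tuple avoids `x` or has it in
-- one of `suc i` places, while a sublist avoids `x` or begins with it.
∑-tuples≡i!*∑-choose : {A : Set} (i : ℕ) (xs : List A) (w : List A → ℕ) →
                 (∀ {S S′} → S ↭ S′ → w S ≡ w S′) → (∀ y S → w (y ∷ y ∷ S) ≡ 0) →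
                 ∑-tuples i xs (w ∘ toList) ≡ i ! * ∑-choose i xs w
∑-tuples≡i!*∑-choose zero [] w sym-w vanish = sym (trans (ℕ.+-identityʳ _) (trans (ℕ.+-identityʳ _) (ℕ.+-identityʳ _)))
∑-tuples≡i!*∑-choose (suc i) [] w sym-w vanish = sym (ℕ.*-zeroʳ (suc i !))
∑-tuples≡i!*∑-choose zero (x ∷ xs) w sym-w vanish =
  trans (∑-tuples≡i!*∑-choose zero xs w sym-w vanish) (cong (1 *_) (sym (∑-choose-0 x xs w)))
∑-tuples≡i!*∑-choose (suc i) (x ∷ xs) w sym-w vanish = begin
  ∑-tuples (suc i) (x ∷ xs) (w ∘ toList)
    ≡⟨ ∑-tuples-∷ i x xs w sym-w vanish ⟩
  ∑-tuples (suc i) xs (w ∘ toList) + suc i * ∑-tuples i xs (w ∘ (x ∷_) ∘ toList)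
    ≡⟨ cong₂ (λ a b → a + suc i * b) (∑-tuples≡i!*∑-choose (suc i) xs w sym-w vanish)
         (∑-tuples≡i!*∑-choose i xs (w ∘ (x ∷_)) (sym-w ∘ prep x)
           (λ z S → trans (sym-w (_↭_.trans (swap x z refl) (prep z (swap x z refl)))) (vanish z (x ∷ S)))) ⟩
  suc i ! * a + suc i * (i ! * b)
    ≡⟨ cong (suc i ! * a +_) (ℕ.*-assoc (suc i) (i !) b) ⟨
  suc i ! * a + suc i ! * b
    ≡⟨ ℕ.*-distribˡ-+ (suc i !) a b ⟨
  suc i ! * (a + b)
    ≡⟨ cong (suc i ! *_) (∑-choose-suc i x xs w) ⟨
  suc i ! * ∑-choose (suc i) (x ∷ xs) w ∎
  where
  open ≡-Reasoning
  a = ∑-choose (suc i) xs w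
  b = ∑-choose i xs (w ∘ (x ∷_))

-- Words over a finite alphabet

-- The number of ways in which a word of length n introduces exactly m new
-- letters, in prescribed order, when d letters have been seen before it.
rStirling : ℕ → ℕ → ℕ → ℕ
rStirling zero    d zero    = 1
rStirling zero    d (suc m) = 0
rStirling (suc n) d zero    = d * rStirling n d 0
rStirling (suc n) d (suc m) = d * rStirling n d (suc m) + rStirling n (suc d) m

-- The definition peels off the first letter of the word. Here the last one is peeled off: it
-- repeats one of the `suc m + d` letters known by then, or it is the last new letter. This is the
-- shape of the recursion for Stirling numbers.
rStirling-last : ∀ n d m →
  rStirling (suc n) d (suc m) ≡ (suc m + d) * rStirling n d (suc m) + rStirling n d m
rStirling-last zero    d zero    = cong (_+ 1) (trans (ℕ.*-zeroʳ d) (sym (ℕ.*-zeroʳ (1 + d))))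
rStirling-last zero    d (suc m) = cong (_+ 0) (trans (ℕ.*-zeroʳ d) (sym (ℕ.*-zeroʳ (suc (suc m) + d))))
rStirling-last (suc n) d zero    = trans
  (cong (λ x → d * x + suc d * rStirling n (suc d) 0) (rStirling-last n d zero))
  (solve 4 (λ d a b c → d :* ((con 1 :+ d) :* a :+ b) :+ (con 1 :+ d) :* c
                      := (con 1 :+ d) :* (d :* a :+ c) :+ d :* b)
         refl d (rStirling n d 1) (rStirling n d 0) (rStirling n (suc d) 0))
  where open ℕ-Solver.+-*-Solver
rStirling-last (suc n) d (suc m) = trans
  (cong₂ (λ x y → d * x + y) (rStirling-last n d (suc m)) (rStirling-last n (suc d) m))
  (solve 6 (λ d m a b c e → d :* ((con 2 :+ m :+ d) :* a :+ b) :+ ((con 1 :+ m :+ (con 1 :+ d)) :* c :+ e)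
                          := (con 2 :+ m :+ d) :* (d :* a :+ c) :+ (d :* b :+ e))
         refl d m (rStirling n d (suc (suc m))) (rStirling n d (suc m))
                  (rStirling n (suc d) (suc m)) (rStirling n (suc d) m))
  where open ℕ-Solver.+-*-Solver

-- The single letter seen in advance acts as an extra element, whose block is never empty; this is
-- where `suc n` and `suc m` come from.
rStirling≡stirling2 : ∀ n m → rStirling n 1 m ≡ stirling2 (suc n) (suc m)
rStirling≡stirling2 zero    zero    = refl
rStirling≡stirling2 zero    (suc m) = sym (trans (ℕ.+-identityʳ _) (ℕ.*-zeroʳ m))
rStirling≡stirling2 (suc n) zero    = trans (cong (1 *_) (rStirling≡stirling2 n 0)) (sym (ℕ.+-identityʳ _))
rStirling≡stirling2 (suc n) (suc m) = trans (rStirling-last n 1 m)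
  (cong₂ _+_ (cong₂ _*_ (ℕ.+-comm (suc m) 1) (rStirling≡stirling2 n (suc m))) (rStirling≡stirling2 n m))

rStirling-zero : ∀ {n d m} → n < m → rStirling n d m ≡ 0
rStirling-zero {zero}      (s≤s _)   = refl
rStirling-zero {suc n} {d} (s≤s n<m) = cong₂ _+_
  (trans (cong (d *_) (rStirling-zero (ℕ.m<n⇒m<1+n n<m))) (ℕ.*-zeroʳ d)) (rStirling-zero n<m)

rStirling-diagonal : ∀ n d → rStirling n d n ≡ 1
rStirling-diagonal zero    d = refl
rStirling-diagonal (suc n) d = cong₂ _+_
  (trans (cong (d *_) (rStirling-zero (ℕ.n<1+n n))) (ℕ.*-zeroʳ d)) (rStirling-diagonal n (suc d))

∣-∑-upTo : ∀ {d} {f : ℕ → ℕ} n → (∀ m → m < n → d ∣ f m) → d ∣ ∑ (upTo n) f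
∣-∑-upTo {d} zero    h = d ∣0
∣-∑-upTo {d} {f} (suc n) h = subst (d ∣_) (sym (∑-upTo-last n f))
  (∣m∣n⇒∣m+n (∣-∑-upTo n (λ m m<n → h m (ℕ.m<n⇒m<1+n m<n))) (h n (ℕ.n<1+n n)))

-- As the diagonal entry is 1, relation n writes `a n` as a multiple of `d` minus a combination of
-- earlier `a m`, which are divisible by induction.
∣-unitriangular : ∀ {d} (t : ℕ → ℕ → ℕ) (a : ℕ → ℕ) → (∀ n → t n n ≡ 1) →
                  (∀ n → d ∣ ∑ (upTo (suc n)) (λ m → t n m * a m)) → ∀ n → d ∣ a n
∣-unitriangular {d} t a diag div = <-rec (λ n → d ∣ a n) λ n rec →
  ∣m+n∣m⇒∣n
    (subst (d ∣_) (trans (∑-upTo-last n (λ m → t n m * a m))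
                         (cong (∑ (upTo n) (λ m → t n m * a m) +_) (trans (cong (_* a n) (diag n)) (ℕ.*-identityˡ _))))
           (div n))
    (∣-∑-upTo n (λ m m<n → ∣n⇒∣m*n (t n m) (rec m<n)))

∑-positive : {A : Set} {f g : A → ℕ} (xs : List A) → (∀ x → 0 < f x → 0 < g x) → 0 < ∑ xs f → 0 < ∑ xs g
∑-positive {f = f} (x ∷ xs) h p with f x in eq
... | zero  = ℕ.≤-trans (∑-positive xs h p) (ℕ.m≤n+m _ _)
... | suc _ = ℕ.≤-trans (h x (subst (0 <_) (sym eq) (s≤s z≤n))) (ℕ.m≤m+n _ _)

∑-vanish : {A : Set} {f g : A → ℕ} (xs : List A) → ∑ xs f ≡ 0 → ∑ xs (λ x → f x * g x) ≡ 0
∑-vanish []       eq = refl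
∑-vanish {f = f} {g} (x ∷ xs) eq = cong₂ _+_
  (cong (_* g x) (ℕ.m+n≡0⇒m≡0 (f x) eq)) (∑-vanish xs (ℕ.m+n≡0⇒n≡0 (f x) eq))

-- The form in which invariance under deleting redundant columns enters; `D` holds the letters that
-- count as seen before the word begins.
Absorbs : {A : Set} → List A → (List A → ℕ) → Set
Absorbs D W = ∀ p {c} q → c ∈ D ⊎ c ∈ p → W (p ++ c ∷ q) ≡ W (p ++ q)

module _ {A : Set} (_≟_ : DecidableEquality A) (xs : List A)
         (once : ∀ d → ∑ xs (λ c → 𝟙 (c ≟ d)) ≡ 1) where

  _∈?_ : ∀ c D → Dec (c ∈ D)
  c ∈? D = any? (c ≟_) D

  count-∈ : ∀ {D} → Unique D → ∑ xs (λ c → 𝟙 (c ∈? D)) ≡ length D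
  count-∈ []           = ∑-zero (λ _ → refl) xs
  count-∈ {d ∷ D} (d∉D ∷ uniq) = begin
    ∑ xs (λ c → 𝟙 (c ∈? (d ∷ D)))                   ≡⟨ ∑-cong split xs ⟩
    ∑ xs (λ c → 𝟙 (c ≟ d) + 𝟙 (c ∈? D))             ≡⟨ ∑-+ xs _ _ ⟩
    ∑ xs (λ c → 𝟙 (c ≟ d)) + ∑ xs (λ c → 𝟙 (c ∈? D)) ≡⟨ cong₂ _+_ (once d) (count-∈ uniq) ⟩
    suc (length D) ∎
    where
    open ≡-Reasoning
    split : ∀ c → 𝟙 (c ∈? (d ∷ D)) ≡ 𝟙 (c ≟ d) + 𝟙 (c ∈? D)
    split c with c ≟ d
    ... | yes refl = sym (cong suc (𝟙-no (c ∈? D) (All.All¬⇒¬Any d∉D)))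
    ... | no _     = refl

  count-∉ : ∀ {D} → Unique D → ∑ xs (λ c → 𝟙 (¬? (c ∈? D))) + length D ≡ length xs
  count-∉ {D} uniq = begin
    ∑ xs (λ c → 𝟙 (¬? (c ∈? D))) + length D                      ≡⟨ cong (∑ xs (λ c → 𝟙 (¬? (c ∈? D))) +_) (count-∈ uniq) ⟨
    ∑ xs (λ c → 𝟙 (¬? (c ∈? D))) + ∑ xs (λ c → 𝟙 (c ∈? D))       ≡⟨ ∑-+ xs _ _ ⟨
    ∑ xs (λ c → 𝟙 (¬? (c ∈? D)) + 𝟙 (c ∈? D))                    ≡⟨ ∑-cong total xs ⟩
    ∑ xs (λ _ → 1)                                               ≡⟨ ones xs ⟩
    length xs ∎
    where
    open ≡-Reasoning
    total : ∀ c → 𝟙 (¬? (c ∈? D)) + 𝟙 (c ∈? D) ≡ 1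
    total c with c ∈? D
    ... | yes _ = refl
    ... | no _  = refl
    ones : ∀ (ys : List A) → ∑ ys (λ _ → 1) ≡ length ys
    ones []       = refl
    ones (y ∷ ys) = cong suc (ones ys)

  extend-unique : ∀ {c : A} {D : List A} → c ∉ D → Unique D → Unique (c ∷ D)
  extend-unique c∉D uniq = All.¬Any⇒All¬ _ c∉D ∷ uniq

  -- The injective words avoiding `D` are the reduced words: what is left of a word when every
  -- absorbed letter is deleted.
  ∑-fresh : ℕ → List A → (List A → ℕ) → ℕ
  ∑-fresh zero    D W = W []
  ∑-fresh (suc m) D W = ∑ xs λ c → 𝟙 (¬? (c ∈? D)) * ∑-fresh m (c ∷ D) (W ∘ (c ∷_))

  -- A first letter in `D` is absorbed, and there are `length D` such letters; a fresh one joins `D`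
  -- and the reduced word. This is the recursion of `rStirling`. Any `M` above `n` serves, since
  -- `rStirling n d m` is 0 for m > n; divisibility and the final formula use different values of
  -- `M`.
  ∑-tuples-by-letters : ∀ n M D W → n < M → Unique D → Absorbs D W →
    ∑-tuples n xs (W ∘ toList) ≡ ∑ (upTo M) (λ m → rStirling n (length D) m * ∑-fresh m D W)
  ∑-tuples-by-letters zero (suc M) D W _ uniq abs = sym (trans (∑-upTo-suc M _)
    (trans (cong (1 * W [] +_) (∑-zero (λ _ → refl) (upTo M))) (trans (ℕ.+-identityʳ _) (ℕ.+-identityʳ _))))
  ∑-tuples-by-letters (suc n) (suc M) D W (s≤s n<M) uniq abs = begin
    ∑ xs (λ c → ∑-tuples n xs (W ∘ (c ∷_) ∘ toList))
      ≡⟨ ∑-cong step xs ⟩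
    ∑ xs (λ c → 𝟙 (c ∈? D) * old + ∑ (upTo M) (λ m → r′ m * (𝟙 (¬? (c ∈? D)) * ∑-fresh m (c ∷ D) (W ∘ (c ∷_)))))
      ≡⟨ ∑-+ xs _ _ ⟩
    ∑ xs (λ c → 𝟙 (c ∈? D) * old) +
    ∑ xs (λ c → ∑ (upTo M) (λ m → r′ m * (𝟙 (¬? (c ∈? D)) * ∑-fresh m (c ∷ D) (W ∘ (c ∷_)))))
      ≡⟨ cong₂ _+_ (trans (∑-*ʳ old xs _) (cong (_* old) (count-∈ uniq)))
                   (trans (∑-swap xs (upTo M) _) (∑-cong (λ m → ∑-*ˡ (r′ m) xs _) (upTo M))) ⟩
    d * old + ∑ (upTo M) (λ m → r′ m * ∑-fresh (suc m) D W)
      ≡⟨ cong (λ s → s + ∑ (upTo M) (λ m → r′ m * ∑-fresh (suc m) D W))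
           (trans (sym (∑-*ˡ d (upTo (suc M)) _)) (∑-upTo-suc M _)) ⟩
    d * (rStirling n d 0 * W []) + ∑ (upTo M) (λ m → d * (rStirling n d (suc m) * ∑-fresh (suc m) D W)) +
    ∑ (upTo M) (λ m → r′ m * ∑-fresh (suc m) D W)
      ≡⟨ ℕ.+-assoc (d * (rStirling n d 0 * W [])) _ _ ⟩
    d * (rStirling n d 0 * W []) + (∑ (upTo M) (λ m → d * (rStirling n d (suc m) * ∑-fresh (suc m) D W)) +
    ∑ (upTo M) (λ m → r′ m * ∑-fresh (suc m) D W))
      ≡⟨ cong₂ _+_ (sym (ℕ.*-assoc d _ _)) (sym (∑-+ (upTo M) _ _)) ⟩
    d * rStirling n d 0 * W [] + ∑ (upTo M) (λ m → d * (rStirling n d (suc m) * ∑-fresh (suc m) D W) +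
                                                    r′ m * ∑-fresh (suc m) D W)
      ≡⟨ cong (d * rStirling n d 0 * W [] +_) (∑-cong (λ m →
           solve 4 (λ d a b f → d :* (a :* f) :+ b :* f := (d :* a :+ b) :* f) refl
             d (rStirling n d (suc m)) (r′ m) (∑-fresh (suc m) D W)) (upTo M)) ⟩
    d * rStirling n d 0 * W [] + ∑ (upTo M) (λ m → rStirling (suc n) d (suc m) * ∑-fresh (suc m) D W)
      ≡⟨ ∑-upTo-suc M (λ m → rStirling (suc n) d m * ∑-fresh m D W) ⟨
    ∑ (upTo (suc M)) (λ m → rStirling (suc n) d m * ∑-fresh m D W) ∎
    where
    open ≡-Reasoning
    open ℕ-Solver.+-*-Solver using (solve; _:+_; _:*_; _:=_)
    d = length D
    r′ : ℕ → ℕ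
    r′ m = rStirling n (suc d) m
    old = ∑ (upTo (suc M)) (λ m → rStirling n d m * ∑-fresh m D W)
    step : ∀ c → ∑-tuples n xs (W ∘ (c ∷_) ∘ toList) ≡
           𝟙 (c ∈? D) * old + ∑ (upTo M) (λ m → r′ m * (𝟙 (¬? (c ∈? D)) * ∑-fresh m (c ∷ D) (W ∘ (c ∷_))))
    step c with c ∈? D
    ... | yes c∈D = trans (∑-tuples-cong n xs (λ v → abs [] (toList v) (inj₁ c∈D)))
                   (trans (∑-tuples-by-letters n (suc M) D W (ℕ.m<n⇒m<1+n n<M) uniq abs)
                   (sym (trans (cong (old + 0 +_) (∑-zero (λ m → ℕ.*-zeroʳ (r′ m)) (upTo M)))
                               (trans (ℕ.+-identityʳ _) (ℕ.+-identityʳ _)))))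
    ... | no c∉D  = trans (∑-tuples-by-letters n M (c ∷ D) (W ∘ (c ∷_)) n<M (extend-unique c∉D uniq)
                            (λ p q → abs (c ∷ p) q ∘ λ { (inj₁ (here eq)) → inj₂ (here eq)
                                                       ; (inj₁ (there i)) → inj₁ i
                                                       ; (inj₂ i) → inj₂ (there i) }))
                         (∑-cong (λ m → cong (r′ m *_) (sym (ℕ.+-identityʳ _))) (upTo M))

  -- The bound is the falling factorial N(N-1)⋯(N-m+1), cleared of the denominator `(N ∸ m) !`; `N`
  -- counts the letters outside `D`, and each choice uses up one of them.
  ∑-fresh-≤ : ∀ m {N D W} → Unique D → N + length D ≡ length xs → m ≤ N → (∀ u → W u ≤ 1) →
              ∑-fresh m D W * (N ∸ m) ! ≤ N !
  ∑-fresh-≤ zero {N} {W = W} uniq eq m≤N W≤1 = subst (W [] * N ! ≤_) (ℕ.*-identityˡ (N !)) (ℕ.*-monoˡ-≤ (N !) (W≤1 []))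
  ∑-fresh-≤ (suc m) {suc N} {D} {W} uniq eq (s≤s m≤N) W≤1 = begin
    ∑ xs (λ c → 𝟙 (¬? (c ∈? D)) * ∑-fresh m (c ∷ D) (W ∘ (c ∷_))) * (N ∸ m) !
      ≡⟨ ∑-*ʳ ((N ∸ m) !) xs _ ⟨
    ∑ xs (λ c → 𝟙 (¬? (c ∈? D)) * ∑-fresh m (c ∷ D) (W ∘ (c ∷_)) * (N ∸ m) !)
      ≤⟨ ∑-mono step xs ⟩
    ∑ xs (λ c → 𝟙 (¬? (c ∈? D)) * N !)
      ≡⟨ ∑-*ʳ (N !) xs _ ⟩
    ∑ xs (λ c → 𝟙 (¬? (c ∈? D))) * N !
      ≡⟨ cong (_* N !) (ℕ.+-cancelʳ-≡ (length D) _ _ (trans (count-∉ uniq) (sym eq))) ⟩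
    suc N * N ! ∎
    where
    open ℕ.≤-Reasoning
    step : ∀ c → 𝟙 (¬? (c ∈? D)) * ∑-fresh m (c ∷ D) (W ∘ (c ∷_)) * (N ∸ m) ! ≤ 𝟙 (¬? (c ∈? D)) * N !
    step c with c ∈? D
    ... | yes _  = z≤n
    ... | no c∉D = ℕ.≤-trans
      (ℕ.≤-reflexive (cong (_* (N ∸ m) !) (ℕ.+-identityʳ (∑-fresh m (c ∷ D) (W ∘ (c ∷_))))))
      (ℕ.≤-trans (∑-fresh-≤ m (extend-unique c∉D uniq) (trans (ℕ.+-suc N _) eq) m≤N (λ u → W≤1 (c ∷ u)))
               (ℕ.≤-reflexive (sym (ℕ.+-identityʳ _))))

  -- Pigeonhole: only `N` letters lie outside `D`.
  ∑-fresh-zero : ∀ m {N D W} → Unique D → N + length D ≡ length xs → N < m → ∑-fresh m D W ≡ 0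
  ∑-fresh-zero (suc m) {zero} uniq eq _ =
    ∑-vanish xs (ℕ.+-cancelʳ-≡ _ _ 0 (trans (count-∉ uniq) (sym eq)))
  ∑-fresh-zero (suc m) {suc N} {D} {W} uniq eq (s≤s N<m) = ∑-zero step xs
    where
    step : ∀ c → 𝟙 (¬? (c ∈? D)) * ∑-fresh m (c ∷ D) (W ∘ (c ∷_)) ≡ 0
    step c with c ∈? D
    ... | yes _  = refl
    ... | no c∉D = trans (ℕ.+-identityʳ _)
      (∑-fresh-zero m (extend-unique c∉D uniq) (trans (ℕ.+-suc N _) eq) N<m)

  ∑-fresh-vanish : ∀ m {D W} → (∀ u → length u ≡ m → W u ≡ 0) → ∑-fresh m D W ≡ 0
  ∑-fresh-vanish zero    h = h [] refl
  ∑-fresh-vanish (suc m) {D} h = ∑-zero (λ c → trans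
    (cong (𝟙 (¬? (c ∈? D)) *_) (∑-fresh-vanish m (λ u eq → h (c ∷ u) (cong suc eq))))
    (ℕ.*-zeroʳ (𝟙 (¬? (c ∈? D))))) xs

  -- A single positive term suffices: the prefix `p` completed by any fresh letters. The length
  -- bound ensures that a fresh letter is available at every step.
  ∑-fresh-positive : ∀ p m {D W} → Unique D → Unique p → All (_∉ D) p →
    length p + m + length D ≤ length xs → (∀ q → 0 < W (p ++ q)) → 0 < ∑-fresh (length p + m) D W
  ∑-fresh-positive [] zero    uniq _ _ le pos = pos []
  ∑-fresh-positive [] (suc m) {D} {W} uniq _ _ le pos =
    ∑-positive xs step (ℕ.+-cancelʳ-< (length D) _ _
      (ℕ.≤-trans (s≤s (ℕ.m≤n+m (length D) m)) (ℕ.≤-trans le (ℕ.≤-reflexive (sym (count-∉ uniq))))))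
    where
    step : ∀ c → 0 < 𝟙 (¬? (c ∈? D)) → 0 < 𝟙 (¬? (c ∈? D)) * ∑-fresh m (c ∷ D) (W ∘ (c ∷_))
    step c p with c ∈? D
    ... | no c∉D = subst (0 <_) (sym (ℕ.+-identityʳ _))
      (∑-fresh-positive [] m (extend-unique c∉D uniq) [] []
        (ℕ.≤-trans (ℕ.≤-reflexive (ℕ.+-suc m _)) le) (λ q → pos (c ∷ q)))
  ∑-fresh-positive (a ∷ p) m {D} {W} uniq (a∉p ∷ uniq-p) (a∉D ∷ p∉D) le pos =
    ∑-positive xs step (subst (0 <_) (sym (once a)) (s≤s z≤n))
    where
    step : ∀ c → 0 < 𝟙 (c ≟ a) → 0 < 𝟙 (¬? (c ∈? D)) * ∑-fresh (length p + m) (c ∷ D) (W ∘ (c ∷_))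
    step c lt with c ≟ a
    ... | yes refl = subst (0 <_)
      (sym (trans (cong (_* ∑-fresh (length p + m) (c ∷ D) (W ∘ (c ∷_))) (𝟙-yes (¬? (c ∈? D)) a∉D)) (ℕ.+-identityʳ _)))
      (∑-fresh-positive p m (extend-unique a∉D uniq) uniq-p
        (both a∉p p∉D)
        (ℕ.≤-trans (ℕ.≤-reflexive (ℕ.+-suc (length p + m) _)) le) (λ q → pos q))
      where
      both : ∀ {p} → All (a ≢_) p → All (_∉ D) p → All (_∉ (a ∷ D)) p
      both [] [] = []
      both (x ∷ xs) (y ∷ ys) = (λ { (here eq) → x (sym eq) ; (there i) → y i }) ∷ both xs ys

-- Broken circuits

infix 4 _≺_

data _≺_ : ∀ {n} → Vec Bool n → Vec Bool n → Set where
  false≺true : ∀ {n} {v w : Vec Bool n} → false ∷ v ≺ true ∷ w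
  _∷_        : ∀ {n} b {v w : Vec Bool n} → v ≺ w → b ∷ v ≺ b ∷ w

_≺?_ : ∀ {n} (v w : Vec Bool n) → Dec (v ≺ w)
[]          ≺? []          = no λ ()
(false ∷ v) ≺? (true ∷ w)  = yes false≺true
(true ∷ v)  ≺? (false ∷ w) = no λ ()
(true ∷ v)  ≺? (true ∷ w)  with v ≺? w
... | yes p = yes (true ∷ p)
... | no ¬p = no λ { (_ ∷ p) → ¬p p }
(false ∷ v) ≺? (false ∷ w) with v ≺? w
... | yes p = yes (false ∷ p)
... | no ¬p = no λ { (_ ∷ p) → ¬p p }

≺-irrefl : ∀ {n} {v : Vec Bool n} → ¬ v ≺ v
≺-irrefl (_ ∷ p) = ≺-irrefl p

≺-asym : ∀ {n} {v w : Vec Bool n} → v ≺ w → ¬ w ≺ v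
≺-asym (_ ∷ p) (_ ∷ q) = ≺-asym p q

∈-allSubsets : ∀ {n} (v : Vec Bool n) → v ∈ allSubsets n
∈-allSubsets []          = here refl
∈-allSubsets (true ∷ v)  = ∈-++⁺ˡ (∈-map⁺ (true ∷_) (∈-allSubsets v))
∈-allSubsets (false ∷ v) = ∈-++⁺ʳ (map (true ∷_) (allSubsets _)) (∈-map⁺ (false ∷_) (∈-allSubsets v))

∈-resonance⁺ : ∀ {n} {v : Vec Bool n} → T (nonempty v) → v ∈ resonance n
∈-resonance⁺ {v = v} ne = ∈-filter⁺ (T? ∘ nonempty) (∈-allSubsets v) ne

∈-resonance⁻ : ∀ {n} {v : Vec Bool n} → v ∈ resonance n → T (nonempty v)
∈-resonance⁻ {n} i = proj₂ (∈-filter⁻ (T? ∘ nonempty) {xs = allSubsets n} i)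

Decreasing : ∀ {n} → List (Vec Bool n) → Set
Decreasing = AllPairs (flip _≺_)

-- The enumeration puts `true` first, so the head of a list is its largest element; the inductions
-- on arrangements remove the largest hyperplane first.
allSubsets-decreasing : ∀ n → Decreasing (allSubsets n)
allSubsets-decreasing zero    = [] ∷ []
allSubsets-decreasing (suc n) = AllPairs.++⁺
  (AllPairs.map⁺ (AllPairs.map (true ∷_) (allSubsets-decreasing n)))
  (AllPairs.map⁺ (AllPairs.map (false ∷_) (allSubsets-decreasing n)))
  (All.map⁺ (All.universal (λ _ → All.map⁺ (All.universal (λ _ → false≺true) (allSubsets n))) (allSubsets n)))

resonance-decreasing : ∀ n → Decreasing (resonance n)
resonance-decreasing n = AllPairs.filter⁺ (T? ∘ nonempty) (allSubsets-decreasing n)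

normals : ∀ {n} → List (Vec Bool n) → List (Vec ℚ n)
normals = map normal

normal-empty : ∀ {n} {v : Vec Bool n} → ¬ T (nonempty v) → normal v ≡ 𝟘
normal-empty {v = []}        _ = refl
normal-empty {v = true ∷ v}  e = contradiction _ e
normal-empty {v = false ∷ v} e = cong (0ℚ ∷_) (normal-empty e)

below : ∀ {n} → Vec Bool n → List (Vec Bool n) → List (Vec Bool n)
below y = filter (_≺? y)

-- y completes a circuit of which y is the largest element.
Broken : ∀ {n} → List (Vec Bool n) → Vec Bool n → Set
Broken S y = Span (normals (below y S)) (normal y)

broken? : ∀ {n} (S : List (Vec Bool n)) y → Dec (Broken S y)
broken? S y = span? (normals (below y S)) (normal y)

-- The elements `y` of the ambient list `xs` that belong to `S` are tested as well: if such a `y`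
-- fails, `S` contains the whole circuit. Hence `NBC` entails independence for sublists of a
-- decreasing list.
NBC : ∀ {n} → List (Vec Bool n) → List (Vec Bool n) → Set
NBC xs S = All (λ y → ¬ Broken S y) xs

nbc? : ∀ {n} (xs S : List (Vec Bool n)) → Dec (NBC xs S)
nbc? xs S = All.all? (λ y → ¬? (broken? S y)) xs

All-sublists : ∀ {A : Set} {P : A → Set} {xs : List A} → All P xs → All (All P) (sublists xs)
All-sublists []       = [] ∷ []
All-sublists (p ∷ ps) = All.++⁺ (All-sublists ps) (All.map⁺ (All.map (p ∷_) (All-sublists ps)))

sumℤ-++ : ∀ xs ys → sumℤ (xs ++ ys) ≡ sumℤ xs ℤ.+ sumℤ ys
sumℤ-++ []       ys = sym (ℤ.+-identityˡ _)
sumℤ-++ (x ∷ xs) ys = trans (cong (ℤ._+_ x) (sumℤ-++ xs ys)) (sym (ℤ.+-assoc x _ _))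

∑ℤ : {A : Set} → List A → (A → ℤ) → ℤ
∑ℤ xs f = sumℤ (map f xs)

∑ℤ-cong : {A : Set} {f g : A → ℤ} {xs : List A} → All (λ x → f x ≡ g x) xs → ∑ℤ xs f ≡ ∑ℤ xs g
∑ℤ-cong []       = refl
∑ℤ-cong (e ∷ es) = cong₂ ℤ._+_ e (∑ℤ-cong es)

∑ℤ-+ : {A : Set} (xs : List A) (f g : A → ℤ) → ∑ℤ xs (λ x → f x ℤ.+ g x) ≡ ∑ℤ xs f ℤ.+ ∑ℤ xs g
∑ℤ-+ []       f g = refl
∑ℤ-+ (x ∷ xs) f g = trans (cong (ℤ._+_ (f x ℤ.+ g x)) (∑ℤ-+ xs f g))
  (solve 4 (λ a b c d → (a :+ b) :+ (c :+ d) := (a :+ c) :+ (b :+ d)) refl (f x) (g x) (∑ℤ xs f) (∑ℤ xs g))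
  where open ℤ-Solver.+-*-Solver

∑ℤ-sublists-∷ : {A : Set} (x : A) (xs : List A) (f : List A → ℤ) →
                ∑ℤ (sublists (x ∷ xs)) f ≡ ∑ℤ (sublists xs) (λ S → f S ℤ.+ f (x ∷ S))
∑ℤ-sublists-∷ x xs f = trans (cong sumℤ (map-++ f (sublists xs) _))
  (trans (sumℤ-++ (map f (sublists xs)) _)
  (trans (cong (λ l → ∑ℤ (sublists xs) f ℤ.+ sumℤ l) (sym (map-∘ (sublists xs))))
         (sym (∑ℤ-+ (sublists xs) f (λ S → f (x ∷ S))))))

∑ℤ-* : {A : Set} (c : ℤ) (xs : List A) (f : A → ℕ) → ∑ℤ xs (λ x → c ℤ.* ℤ.+ f x) ≡ c ℤ.* ℤ.+ ∑ xs f
∑ℤ-* c []       f = sym (ℤ.*-zeroʳ c)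
∑ℤ-* c (x ∷ xs) f = trans (cong (ℤ._+_ (c ℤ.* ℤ.+ f x)) (∑ℤ-* c xs f))
  (sym (trans (cong (c ℤ.*_) (ℤ.pos-+ (f x) _)) (ℤ.*-distribˡ-+ c (ℤ.+ f x) _)))


module _ {n : ℕ} {x : Vec Bool n} {S : List (Vec Bool n)} (S≺x : All (_≺ x) S) where

  below-top : below x S ≡ S
  below-top = filter-all (_≺? x) S≺x

  below-top-∷ : below x (x ∷ S) ≡ S
  below-top-∷ = trans (filter-reject (_≺? x) ≺-irrefl) below-top

  -- As `x` exceeds every element of `xs`, it is never among the smaller elements on which a test in
  -- `xs` relies.
  NBC-∷ : ∀ {xs} → All (_≺ x) xs → NBC xs (x ∷ S) → NBC xs S
  NBC-∷ []         []         = []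
  NBC-∷ (lt ∷ lts) (nb ∷ nbs) =
    subst (λ l → ¬ Span (normals l) _) (filter-reject (_≺? _) (≺-asym lt)) nb ∷ NBC-∷ lts nbs

  NBC-∷⁻ : ∀ {xs} → All (_≺ x) xs → NBC xs S → NBC xs (x ∷ S)
  NBC-∷⁻ []         []         = []
  NBC-∷⁻ (lt ∷ lts) (nb ∷ nbs) =
    subst (λ l → ¬ Span (normals l) _) (sym (filter-reject (_≺? _) (≺-asym lt))) nb ∷ NBC-∷⁻ lts nbs

-- The induction in `whitney` replaces `g` by the difference of `g S` and `g (x ∷ S)`. It needs a
-- class of functions closed under this operation; indicators of a given rank are not.
SpanInvariant : ∀ {n} → (List (Vec Bool n) → ℤ) → Set
SpanInvariant g = ∀ {S S′} → normals S ≼ normals S′ → normals S′ ≼ normals S → g S ≡ g S′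

-- If x ∈ span {s ∈ S : s ≺ x}, then S and x ∷ S have the same span and opposite signs,
-- so only the sets without broken circuits survive.
whitney : ∀ {n} (xs : List (Vec Bool n)) → Decreasing xs →
          (g : List (Vec Bool n) → ℤ) → SpanInvariant g →
          ∑ℤ (sublists xs) (λ S → sign (length S) ℤ.* g S) ≡
          ∑ℤ (sublists xs) (λ S → sign (length S) ℤ.* (ℤ.+ 𝟙 (nbc? xs S) ℤ.* g S))
whitney [] dec g inv = cong (λ z → ℤ.+ 1 ℤ.* z ℤ.+ ℤ.+ 0) (sym (ℤ.*-identityˡ (g [])))
whitney (x ∷ xs) (x≻xs ∷ dec) g inv = begin
  ∑ℤ (sublists (x ∷ xs)) (λ S → σ S ℤ.* g S)
    ≡⟨ ∑ℤ-sublists-∷ x xs (λ S → σ S ℤ.* g S) ⟩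
  ∑ℤ (sublists xs) (λ S → σ S ℤ.* g S ℤ.+ ℤ.- σ S ℤ.* g (x ∷ S))
    ≡⟨ ∑ℤ-cong (All.universal (λ S → solve 3 (λ s a b → s :* a :+ (:- s) :* b := s :* (a :- b)) refl
                                       (σ S) (g S) (g (x ∷ S))) (sublists xs)) ⟩
  ∑ℤ (sublists xs) (λ S → σ S ℤ.* (g S ℤ.- g (x ∷ S)))
    ≡⟨ whitney xs dec (λ S → g S ℤ.- g (x ∷ S)) (λ p q → cong₂ ℤ._-_ (inv p q) (inv (∷-mono-≼ p) (∷-mono-≼ q))) ⟩
  ∑ℤ (sublists xs) (λ S → σ S ℤ.* (ℤ.+ 𝟙 (nbc? xs S) ℤ.* (g S ℤ.- g (x ∷ S))))
    ≡⟨ ∑ℤ-cong (All.map (λ {S} → step S) (All-sublists x≻xs)) ⟩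
  ∑ℤ (sublists xs) (λ S → σ S ℤ.* (ℤ.+ 𝟙 (nbc? (x ∷ xs) S) ℤ.* g S) ℤ.+
                          ℤ.- σ S ℤ.* (ℤ.+ 𝟙 (nbc? (x ∷ xs) (x ∷ S)) ℤ.* g (x ∷ S)))
    ≡⟨ ∑ℤ-sublists-∷ x xs (λ S → σ S ℤ.* (ℤ.+ 𝟙 (nbc? (x ∷ xs) S) ℤ.* g S)) ⟨
  ∑ℤ (sublists (x ∷ xs)) (λ S → σ S ℤ.* (ℤ.+ 𝟙 (nbc? (x ∷ xs) S) ℤ.* g S)) ∎
  where
  open ≡-Reasoning
  open ℤ-Solver.+-*-Solver
  σ : List _ → ℤ
  σ S = sign (length S)
  step : ∀ S → All (_≺ x) S →
         σ S ℤ.* (ℤ.+ 𝟙 (nbc? xs S) ℤ.* (g S ℤ.- g (x ∷ S))) ≡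
         σ S ℤ.* (ℤ.+ 𝟙 (nbc? (x ∷ xs) S) ℤ.* g S) ℤ.+
         ℤ.- σ S ℤ.* (ℤ.+ 𝟙 (nbc? (x ∷ xs) (x ∷ S)) ℤ.* g (x ∷ S))
  step S S≺x with span? (normals S) (normal x)
  ... | yes p
    rewrite 𝟙-no (nbc? (x ∷ xs) S) (λ { (nb ∷ _) → nb (subst (λ l → Span (normals l) _) (sym (below-top S≺x)) p) })
          | 𝟙-no (nbc? (x ∷ xs) (x ∷ S)) (λ { (nb ∷ _) → nb (subst (λ l → Span (normals l) _) (sym (below-top-∷ S≺x)) p) })
          | inv {x ∷ S} {S} (∷-≼ p ≼-refl) (gen ∘ there)
          = solve 3 (λ s t a → s :* (t :* (a :- a)) := s :* (con (ℤ.+ 0) :* a) :+ (:- s) :* (con (ℤ.+ 0) :* a)) refl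
              (σ S) (ℤ.+ 𝟙 (nbc? xs S)) (g S)
  ... | no ¬p
    rewrite 𝟙-cong (nbc? (x ∷ xs) S) (nbc? xs S) (λ { (_ ∷ nbs) → nbs })
              (subst (λ l → ¬ Span (normals l) _) (sym (below-top S≺x)) ¬p ∷_)
          | 𝟙-cong (nbc? (x ∷ xs) (x ∷ S)) (nbc? xs S) (λ { (_ ∷ nbs) → NBC-∷ S≺x x≻xs nbs })
              (λ nbs → subst (λ l → ¬ Span (normals l) _) (sym (below-top-∷ S≺x)) ¬p ∷ NBC-∷⁻ S≺x x≻xs nbs)
          = solve 4 (λ s t a b → s :* (t :* (a :- b)) := s :* (t :* a) :+ (:- s) :* (t :* b)) refl
              (σ S) (ℤ.+ 𝟙 (nbc? xs S)) (g S) (g (x ∷ S))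

-- Every member of `S` is itself tested against the smaller members, and in a decreasing list these
-- are the ones after it.
NBC⇒independent : ∀ {n} {xs : List (Vec Bool n)} → Decreasing xs →
                  All (λ S → NBC xs S → Independent (normals S)) (sublists xs)
NBC⇒independent []             = (λ _ → _) ∷ []
NBC⇒independent {xs = x ∷ xs} (x≻xs ∷ dec) = All.++⁺
  (All.map (λ { f (_ ∷ nbs) → f nbs }) (NBC⇒independent dec))
  (All.map⁺ (All.zipWith (λ { (S≺x , f) (nb ∷ nbs) →
      subst (λ l → ¬ Span (normals l) _) (below-top-∷ S≺x) nb , f (NBC-∷ S≺x x≻xs nbs) })
    (All-sublists x≻xs , NBC⇒independent dec)))

-- From Betti numbers to tuples of rows

-- Repeating a row or adding a zero row changes no span and thus leaves `NBC` intact; the rank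
-- condition rules such tuples out.
Good : ∀ {n} → List (Vec Bool n) → Set
Good {n} S = rank (normals S) ≡ length S × NBC (resonance n) S

good? : ∀ {n} (S : List (Vec Bool n)) → Dec (Good S)
good? {n} S = rank (normals S) ℕ.≟ length S ×-dec nbc? (resonance n) S

rank-↭ : ∀ {n} {S S′ : List (Vec Bool n)} → S ↭ S′ → rank (normals S) ≡ rank (normals S′)
rank-↭ {S = S} {S′} p = rank-cong {vs = normals S} {normals S′}
  (λ i → gen (∈-resp-↭ (map⁺ normal p) i)) (λ i → gen (∈-resp-↭ (map⁺ normal (↭-sym p)) i))

Good-↭ : ∀ {n} {S S′ : List (Vec Bool n)} → S ↭ S′ → Good S → Good S′
Good-↭ p (r , nbs) = trans (sym (rank-↭ p)) (trans r (↭-length p)) ,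
  All.map (λ {y} nb b → nb (Span-mono (λ i → gen (∈-resp-↭ (map⁺ normal (filter-↭ (_≺? y) (↭-sym p))) i)) b)) nbs

𝟙-good-↭ : ∀ {n} {S S′ : List (Vec Bool n)} → S ↭ S′ → 𝟙 (good? S) ≡ 𝟙 (good? S′)
𝟙-good-↭ {S = S} {S′} p = 𝟙-cong (good? S) (good? S′) (Good-↭ p) (Good-↭ (↭-sym p))

¬Good-dependent : ∀ {n} {x : Vec Bool n} {S} → Span (normals S) (normal x) → ¬ Good (x ∷ S)
¬Good-dependent {x = x} {S} p (r , _) =
  proj₁ (rank≡length⇒independent (normals (x ∷ S)) (trans r (sym (length-map normal (x ∷ S))))) p

𝟙-good-repeat : ∀ {n} (x : Vec Bool n) S → 𝟙 (good? (x ∷ x ∷ S)) ≡ 0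
𝟙-good-repeat x S = 𝟙-no (good? (x ∷ x ∷ S)) (¬Good-dependent {S = x ∷ S} (gen (here refl)))

𝟙-good-empty : ∀ {n} (x : Vec Bool n) S → ¬ T (nonempty x) → 𝟙 (good? (x ∷ S)) ≡ 0
𝟙-good-empty x S e = 𝟙-no (good? (x ∷ S))
  (¬Good-dependent {S = S} (subst (Span (normals S)) (sym (normal-empty e)) 𝟘∈))

-- The singletons have the unit vectors as normals. With r(A_n) = n, the exponent n - r(S) equals n
-- - i exactly when r(S) = i.
rank-resonance : ∀ n → rank (normals (resonance n)) ≡ n
rank-resonance n = spanning⇒rank≡dimension _ (λ i → gen (units-normal n i))
  where
  single : ∀ n {v} → v ∈ units n → ∃ λ (s : Vec Bool n) → T (nonempty s) × v ≡ normal s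
  single (suc n) (here refl) = true ∷ Vec.replicate n false , _ ,
    cong (1ℚ ∷_) (sym (normal-empty (empty n)))
    where
    empty : ∀ n → ¬ T (nonempty (Vec.replicate n false))
    empty (suc n) = empty n
  single (suc n) (there i) with ∈-map⁻ (0ℚ ∷_) i
  ... | v , j , refl with single n j
  ...   | s , ne , refl = false ∷ s , ne , refl
  units-normal : ∀ n {v} → v ∈ units n → v ∈ normals (resonance n)
  units-normal n i with single n i
  ... | s , ne , refl = ∈-map⁺ normal (∈-resonance⁺ ne)

∣sign*∣ : ∀ i m → ℤ.∣ sign i ℤ.* ℤ.+ m ∣ ≡ m
∣sign*∣ i m = trans (ℤ.abs-* (sign i) (ℤ.+ m)) (trans (cong (ℕ._* m) (∣sign∣ i)) (ℕ.*-identityˡ m))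
  where
  ∣sign∣ : ∀ i → ℤ.∣ sign i ∣ ≡ 1
  ∣sign∣ zero    = refl
  ∣sign∣ (suc i) = trans (ℤ.∣-i∣≡∣i∣ (sign i)) (∣sign∣ i)

if≡*𝟙 : {P Q : Set} (d : Dec P) (e : Dec Q) (s : ℤ) → (P → Q) → (Q → P) →
        (if does d then s else ℤ.+ 0) ≡ s ℤ.* ℤ.+ 𝟙 e
if≡*𝟙 (yes p) e s f g = sym (trans (cong (λ k → s ℤ.* ℤ.+ k) (𝟙-yes e (f p))) (ℤ.*-identityʳ s))
if≡*𝟙 (no ¬p) e s f g = sym (trans (cong (λ k → s ℤ.* ℤ.+ k) (𝟙-no e (¬p ∘ g))) (ℤ.*-zeroʳ s))

-- By independence an nbc set of rank `i` has `i` elements, so all surviving terms carry the same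
-- sign and the absolute value is their number.
betti≡∑-choose : ∀ n (rk : List (Vec Bool n) → ℕ) → IsRankFn n rk → ∀ i →
                 betti n rk i ≡ ∑-choose i (resonance n) (𝟙 ∘ good?)
betti≡∑-choose n rk isRank i = trans (cong ℤ.∣_∣ (begin
  chiCoeff n rk i
    ≡⟨ ∑ℤ-cong (All.universal term≡ (sublists (resonance n))) ⟩
  ∑ℤ (sublists (resonance n)) (λ S → sign (length S) ℤ.* ℤ.+ 𝟙 (rank (normals S) ℕ.≟ i))
    ≡⟨ whitney (resonance n) (resonance-decreasing n) (λ S → ℤ.+ 𝟙 (rank (normals S) ℕ.≟ i))
         (λ {S} {S′} p q → cong (λ r → ℤ.+ 𝟙 (r ℕ.≟ i)) (rank-cong {vs = normals S} {normals S′} p q)) ⟩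
  ∑ℤ (sublists (resonance n)) (λ S → sign (length S) ℤ.* (ℤ.+ 𝟙 (nbc? (resonance n) S) ℤ.* ℤ.+ 𝟙 (rank (normals S) ℕ.≟ i)))
    ≡⟨ ∑ℤ-cong (All.map (λ {S} → nbc-term S) (NBC⇒independent (resonance-decreasing n))) ⟩
  ∑ℤ (sublists (resonance n)) (λ S → sign i ℤ.* ℤ.+ (𝟙 (length S ℕ.≟ i) ℕ.* 𝟙 (good? S)))
    ≡⟨ ∑ℤ-* (sign i) (sublists (resonance n)) _ ⟩
  sign i ℤ.* ℤ.+ ∑-choose i (resonance n) (𝟙 ∘ good?) ∎))
  (∣sign*∣ i _)
  where
  open ≡-Reasoning
  term≡ : ∀ S → (if does ((ℤ.+ rk (resonance n)) ℤ.- (ℤ.+ rk S) ℤ.≟ (ℤ.+ n) ℤ.- (ℤ.+ i)) then sign (length S) else ℤ.+ 0)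
              ≡ sign (length S) ℤ.* ℤ.+ 𝟙 (rank (normals S) ℕ.≟ i)
  term≡ S rewrite HasRank⇒rank (isRank (resonance n)) | HasRank⇒rank (isRank S) | rank-resonance n =
    if≡*𝟙 ((ℤ.+ n) ℤ.- (ℤ.+ rank (normals S)) ℤ.≟ (ℤ.+ n) ℤ.- (ℤ.+ i)) (rank (normals S) ℕ.≟ i) (sign (length S))
      (λ eq → ℤ.+-injective (ℤ.neg-injective (∙-cancelˡ ℤ.+-0-abelianGroup (ℤ.+ n) _ _ eq)))
      (cong (λ r → (ℤ.+ n) ℤ.- (ℤ.+ r)))
  nbc-term : ∀ S → (NBC (resonance n) S → Independent (normals S)) →
    sign (length S) ℤ.* (ℤ.+ 𝟙 (nbc? (resonance n) S) ℤ.* ℤ.+ 𝟙 (rank (normals S) ℕ.≟ i)) ≡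
    sign i ℤ.* ℤ.+ (𝟙 (length S ℕ.≟ i) ℕ.* 𝟙 (good? S))
  nbc-term S indep with nbc? (resonance n) S
  ... | no ¬nbc rewrite 𝟙-no (rank (normals S) ℕ.≟ length S ×-dec no ¬nbc) (¬nbc ∘ proj₂)
                      | ℕ.*-zeroʳ (𝟙 (length S ℕ.≟ i)) =
    trans (ℤ.*-zeroʳ (sign (length S))) (sym (ℤ.*-zeroʳ (sign i)))
  ... | yes nbc rewrite trans (independent⇒rank≡length _ (indep nbc)) (length-map normal S)
                      | 𝟙-yes (length S ℕ.≟ length S ×-dec yes nbc) (refl , nbc) =
    same-length (length S ℕ.≟ i)
    where
    same-length : ∀ {l} (d : Dec (l ≡ i)) → sign l ℤ.* (ℤ.+ 1 ℤ.* ℤ.+ 𝟙 d) ≡ sign i ℤ.* ℤ.+ (𝟙 d ℕ.* 1)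
    same-length (yes refl)    = refl
    same-length {l} (no _) = trans (ℤ.*-zeroʳ (sign l)) (sym (ℤ.*-zeroʳ (sign i)))

∑-tuples≡i!*betti : ∀ n (rk : List (Vec Bool n) → ℕ) → IsRankFn n rk → ∀ i →
  ∑-tuples i (allSubsets n) (𝟙 ∘ good? ∘ Vec.toList) ≡ i ! ℕ.* betti n rk i
∑-tuples≡i!*betti n rk isRank i = trans
  (∑-tuples≡i!*∑-choose i (allSubsets n) (𝟙 ∘ good?) 𝟙-good-↭ 𝟙-good-repeat)
  (cong (i ! ℕ.*_) (trans
    (∑-choose-filter (T? ∘ nonempty) i (allSubsets n) (𝟙 ∘ good?) 𝟙-good-↭ 𝟙-good-empty)
    (sym (betti≡∑-choose n rk isRank i))))

-- Incidence matrices by columns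

rows : ∀ {i} (u : List (Vec Bool i)) → Vec (Vec Bool (length u)) i
rows []      = replicate _ []
rows (c ∷ u) = zipWith _∷_ c (rows u)

∑-allSubsets-suc : ∀ n (f : Vec Bool (suc n) → ℕ) →
  ∑ (allSubsets (suc n)) f ≡ ∑ (allSubsets n) (f ∘ (true ∷_)) + ∑ (allSubsets n) (f ∘ (false ∷_))
∑-allSubsets-suc n f = trans (∑-++ (map (true ∷_) (allSubsets n)) _ f)
  (cong₂ _+_ (∑-map (true ∷_) (allSubsets n) f) (∑-map (false ∷_) (allSubsets n) f))

∑-tuples-split : ∀ i n (w : Vec (Vec Bool (suc n)) i → ℕ) →
  ∑-tuples i (allSubsets (suc n)) w ≡
  ∑ (allSubsets i) λ c → ∑-tuples i (allSubsets n) (w ∘ zipWith _∷_ c)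
∑-tuples-split zero    n w = sym (ℕ.+-identityʳ _)
∑-tuples-split (suc i) n w = begin
  ∑ (allSubsets (suc n)) (λ x → ∑-tuples i (allSubsets (suc n)) (w ∘ (x ∷_)))
    ≡⟨ ∑-cong (λ x → ∑-tuples-split i n (w ∘ (x ∷_))) (allSubsets (suc n)) ⟩
  ∑ (allSubsets (suc n)) (λ x → ∑ (allSubsets i) (F x))
    ≡⟨ ∑-allSubsets-suc n _ ⟩
  ∑ (allSubsets n) (λ x → ∑ (allSubsets i) (F (true ∷ x))) +
  ∑ (allSubsets n) (λ x → ∑ (allSubsets i) (F (false ∷ x)))
    ≡⟨ cong₂ _+_ (∑-swap (allSubsets n) (allSubsets i) _) (∑-swap (allSubsets n) (allSubsets i) _) ⟩
  ∑ (allSubsets i) (λ c → ∑ (allSubsets n) (λ x → F (true ∷ x) c)) +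
  ∑ (allSubsets i) (λ c → ∑ (allSubsets n) (λ x → F (false ∷ x) c))
    ≡⟨ ∑-allSubsets-suc i _ ⟨
  ∑ (allSubsets (suc i)) (λ c → ∑-tuples (suc i) (allSubsets n) (w ∘ zipWith _∷_ c)) ∎
  where
  open ≡-Reasoning
  F : Vec Bool (suc n) → Vec Bool i → ℕ
  F x c = ∑-tuples i (allSubsets n) (λ R → w (x ∷ zipWith _∷_ c R))

-- `w` is given for all widths at once, since peeling off a column shortens the rows.
∑-tuples-transpose : ∀ i n (w : ∀ n → Vec (Vec Bool n) i → ℕ) →
  ∑-tuples i (allSubsets n) (w n) ≡ ∑-tuples n (allSubsets i) (λ v → w _ (rows (toList v)))
∑-tuples-transpose i zero    w = go i (w 0)
  where
  go : ∀ i (w : Vec (Vec Bool 0) i → ℕ) → ∑-tuples i ([] ∷ []) w ≡ w (replicate i [])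
  go zero    w = refl
  go (suc i) w = trans (ℕ.+-identityʳ _) (go i (w ∘ ([] ∷_)))
∑-tuples-transpose i (suc n) w = trans (∑-tuples-split i n (w (suc n)))
  (∑-cong (λ c → ∑-tuples-transpose i n (λ m R → w (suc m) (zipWith _∷_ c R))) (allSubsets i))

⟦_⟧ : Bool → ℚ
⟦ b ⟧ = if b then 1ℚ else 0ℚ

dot : ∀ {i} → Vec ℚ i → Vec Bool i → ℚ
dot []      []      = 0ℚ
dot (a ∷ v) (b ∷ c) = a ℚ.* ⟦ b ⟧ ℚ.+ dot v c

dot-empty : ∀ {i} (a : Vec ℚ i) → dot a (replicate i false) ≡ 0ℚ
dot-empty []      = refl
dot-empty (x ∷ a) = trans (cong₂ ℚ._+_ (ℚ.*-zeroʳ x) (dot-empty a)) (ℚ.+-identityˡ 0ℚ)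

dot-𝟘 : ∀ {i} (c : Vec Bool i) → dot 𝟘 c ≡ 0ℚ
dot-𝟘 []      = refl
dot-𝟘 (b ∷ c) = trans (cong₂ ℚ._+_ (ℚ.*-zeroˡ ⟦ b ⟧) (dot-𝟘 c)) (ℚ.+-identityˡ 0ℚ)

comb : ∀ {i n} → Vec ℚ i → Vec (Vec Bool n) i → Vec ℚ n
comb a R = lincomb (toList a) (normals (toList R))

comb-zipWith-∷ : ∀ {i n} (a : Vec ℚ i) (c : Vec Bool i) (R : Vec (Vec Bool n) i) →
                 comb a (zipWith _∷_ c R) ≡ dot a c ∷ comb a R
comb-zipWith-∷ []      []      []      = refl
comb-zipWith-∷ (x ∷ a) (b ∷ c) (r ∷ R) = cong (x ⊙ normal (b ∷ r) ⊕_) (comb-zipWith-∷ a c R)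

-- The coefficients are indexed by all rows and vanish at those filtered out, so their type does not
-- depend on which rows are smaller than the target.
Span-filter⇒comb : ∀ {i n} {P : Vec Bool n → Set} (P? : ∀ v → Dec (P v)) (R : Vec (Vec Bool n) i) {y} →
  Span (normals (filter P? (toList R))) y →
  ∃ λ a → (∀ j → lookup a j ≡ 0ℚ ⊎ P (lookup R j)) × comb a R ≡ y
Span-filter⇒comb P? []      p = [] , (λ ()) , sym (Span-[] p)
Span-filter⇒comb P? (r ∷ R) p with P? r
... | no _ = let a , supp , eq = Span-filter⇒comb P? R p in
  0ℚ ∷ a , (λ { zero → inj₁ refl ; (suc j) → supp j }) , trans (⊙𝟘-⊕ (normal r) _) eq
... | yes pr with Span-∷⁻ p
...   | c , z , z∈ , refl = let a , supp , eq = Span-filter⇒comb P? R z∈ in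
  c ∷ a , (λ { zero → inj₂ pr ; (suc j) → supp j }) , cong (c ⊙ normal r ⊕_) eq

comb⇒Span-filter : ∀ {i n} {P : Vec Bool n → Set} (P? : ∀ v → Dec (P v)) (R : Vec (Vec Bool n) i) a →
  (∀ j → lookup a j ≡ 0ℚ ⊎ P (lookup R j)) → Span (normals (filter P? (toList R))) (comb a R)
comb⇒Span-filter P? []      []      supp = 𝟘∈
comb⇒Span-filter P? (r ∷ R) (x ∷ a) supp with P? r | supp zero
... | yes pr | _         = (x ⊡ gen (here refl)) ⊞ Span-weaken (comb⇒Span-filter P? R a (supp ∘ suc))
... | no ¬pr | inj₂ pr   = contradiction pr ¬pr
... | no ¬pr | inj₁ refl =
  subst (Span _) (sym (⊙𝟘-⊕ (normal r) _)) (comb⇒Span-filter P? R a (supp ∘ suc))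

Span⇒comb : ∀ {i n} (R : Vec (Vec Bool n) i) {y} → Span (normals (toList R)) y → ∃ λ a → comb a R ≡ y
Span⇒comb []      p = [] , sym (Span-[] p)
Span⇒comb (r ∷ R) p with Span-∷⁻ p
... | c , z , z∈ , refl = let a , eq = Span⇒comb R z∈ in c ∷ a , cong (c ⊙ normal r ⊕_) eq

independent⇒trivial : ∀ {i n} (R : Vec (Vec Bool n) i) → Independent (normals (toList R)) →
                      ∀ a → comb a R ≡ 𝟘 → a ≡ 𝟘
independent⇒trivial R ind a eq = zeros a (independent⇒LinIndep (normals (toList R)) ind (toList a)
  (trans (Vec.length-toList a) (sym (trans (length-map normal (toList R)) (Vec.length-toList R)))) eq)
  where
  zeros : ∀ {i} (a : Vec ℚ i) → All (_≡ 0ℚ) (toList a) → a ≡ 𝟘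
  zeros []      []       = refl
  zeros (x ∷ a) (e ∷ es) = cong₂ _∷_ e (zeros a es)

trivial⇒independent : ∀ {i n} (R : Vec (Vec Bool n) i) →
                      (∀ a → comb a R ≡ 𝟘 → a ≡ 𝟘) → Independent (normals (toList R))
trivial⇒independent []      triv = tt
trivial⇒independent (r ∷ R) triv = r∉ ,
  trivial⇒independent R (λ a eq → cong Vec.tail (triv (0ℚ ∷ a) (trans (⊙𝟘-⊕ (normal r) _) eq)))
  where
  r∉ : ¬ Span (normals (toList R)) (normal r)
  r∉ p with Span⇒comb R p
  ... | a , eq = contradiction (cong Vec.head (triv (ℚ.- 1ℚ ∷ a)
    (trans (cong ((ℚ.- 1ℚ) ⊙ normal r ⊕_) eq) (⊕-cancel (normal r))))) λ ()

-- The vector x has the entry a · c in the column c of u, that is, x = Σ_j a_j row_j.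
data Values {i} (a : Vec ℚ i) : (u : List (Vec Bool i)) → Vec Bool (length u) → Set where
  []  : Values a [] []
  _∷_ : ∀ {c u b x} → dot a c ≡ ⟦ b ⟧ → Values a u x → Values a (c ∷ u) (b ∷ x)

Values⇒comb : ∀ {i} {a : Vec ℚ i} {u x} → Values a u x → comb a (rows u) ≡ normal x
Values⇒comb {a = a} [] with comb a (replicate _ [])
... | [] = refl
Values⇒comb {a = a} {c ∷ u} (e ∷ vs) = trans (comb-zipWith-∷ a c (rows u)) (cong₂ _∷_ e (Values⇒comb vs))

comb⇒Values : ∀ {i} (a : Vec ℚ i) u {x} → comb a (rows u) ≡ normal x → Values a u x
comb⇒Values a []      {[]}    eq = []
comb⇒Values a (c ∷ u) {b ∷ x} eq with trans (sym (comb-zipWith-∷ a c (rows u))) eq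
... | eq′ = cong Vec.head eq′ ∷ comb⇒Values a u (cong Vec.tail eq′)

-- Row j of the matrix with columns u is lexicographically smaller than Σ_j a_j row_j.
data Less {i} (j : Fin i) (a : Vec ℚ i) : List (Vec Bool i) → Set where
  here  : ∀ {c u} → lookup c j ≡ false → dot a c ≡ 1ℚ → Less j a (c ∷ u)
  there : ∀ {c u} → dot a c ≡ ⟦ lookup c j ⟧ → Less j a u → Less j a (c ∷ u)

⟦⟧-injective : ∀ {b b′} → ⟦ b ⟧ ≡ ⟦ b′ ⟧ → b ≡ b′
⟦⟧-injective {false} {false} _ = refl
⟦⟧-injective {true}  {true}  _ = refl

⟦⟧≡1 : ∀ {b} → ⟦ b ⟧ ≡ 1ℚ → b ≡ true
⟦⟧≡1 = ⟦⟧-injective {b′ = true}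

≺-rows-∷ : ∀ {i} (j : Fin i) c u {x} → lookup c j ∷ lookup (rows u) j ≺ x → lookup (rows (c ∷ u)) j ≺ x
≺-rows-∷ j c u = subst (_≺ _) (sym (Vec.lookup-zipWith _∷_ j c (rows u)))

≺-rows-∷⁻ : ∀ {i} (j : Fin i) c u {x} → lookup (rows (c ∷ u)) j ≺ x → lookup c j ∷ lookup (rows u) j ≺ x
≺-rows-∷⁻ j c u = subst (_≺ _) (Vec.lookup-zipWith _∷_ j c (rows u))

false∷≺true∷ : ∀ {n b b′} {v w : Vec Bool n} → b ≡ false → b′ ≡ true → b ∷ v ≺ b′ ∷ w
false∷≺true∷ refl refl = false≺true

∷-≺ : ∀ {n b b′} {v w : Vec Bool n} → b ≡ b′ → v ≺ w → b ∷ v ≺ b′ ∷ w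
∷-≺ refl l = _ ∷ l

≺-∷⁻ : ∀ {n b b′} {v w : Vec Bool n} → b ∷ v ≺ b′ ∷ w → (b ≡ false × b′ ≡ true) ⊎ (b ≡ b′ × v ≺ w)
≺-∷⁻ false≺true = inj₁ (refl , refl)
≺-∷⁻ (_ ∷ l)    = inj₂ (refl , l)

Less⇒≺ : ∀ {i} {j : Fin i} {a u x} → Values a u x → Less j a u → lookup (rows u) j ≺ x
Less⇒≺ {j = j} {u = c ∷ u} (e ∷ vs) (here f e′)  = ≺-rows-∷ j c u (false∷≺true∷ f (⟦⟧≡1 (trans (sym e) e′)))
Less⇒≺ {j = j} {u = c ∷ u} (e ∷ vs) (there e′ l) =
  ≺-rows-∷ j c u (∷-≺ (⟦⟧-injective (trans (sym e′) e)) (Less⇒≺ vs l))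

≺⇒Less : ∀ {i} {j : Fin i} {a u x} → Values a u x → lookup (rows u) j ≺ x → Less j a u
≺⇒Less [] ()
≺⇒Less {j = j} {a} {c ∷ u} {b ∷ x} (e ∷ vs) l with ≺-∷⁻ (≺-rows-∷⁻ j c u l)
... | inj₁ (f , t)    = here f (trans e (cong ⟦_⟧ t))
... | inj₂ (eq , l′) = there (trans e (cong ⟦_⟧ (sym eq))) (≺⇒Less vs l′)

IsBit : ℚ → Set
IsBit q = q ≡ 0ℚ ⊎ q ≡ 1ℚ

-- A broken circuit of the rows of u, given by its coefficients.
BadCombination : ∀ {i} → List (Vec Bool i) → Vec ℚ i → Set
BadCombination u a = All (IsBit ∘ dot a) u × Any (λ c → dot a c ≡ 1ℚ) u ×
                     (∀ j → lookup a j ≡ 0ℚ ⊎ Less j a u)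

-- Quantifying over coefficient vectors in ℚⁱ, rather than over hyperplanes in ℚⁿ, lets the same
-- witness `a` serve before and after a column is deleted.
GoodColumns : ∀ {i} → List (Vec Bool i) → Set
GoodColumns u = (∀ a → All (λ c → dot a c ≡ 0ℚ) u → a ≡ 𝟘) × (∀ a → ¬ BadCombination u a)

values : ∀ {i} {a : Vec ℚ i} {u} → All (IsBit ∘ dot a) u → ∃ (Values a u)
values []             = [] , []
values (inj₁ e ∷ bs) = let x , vs = values bs in false ∷ x , e ∷ vs
values (inj₂ e ∷ bs) = let x , vs = values bs in true ∷ x , e ∷ vs

values-bits : ∀ {i} {a : Vec ℚ i} {u x} → Values a u x → All (IsBit ∘ dot a) u
values-bits []                   = []
values-bits (_∷_ {b = false} e vs) = inj₁ e ∷ values-bits vs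
values-bits (_∷_ {b = true} e vs)  = inj₂ e ∷ values-bits vs

nonempty⁺ : ∀ {i} {a : Vec ℚ i} {u x} → Values a u x → Any (λ c → dot a c ≡ 1ℚ) u → T (nonempty x)
nonempty⁺ (_∷_ {b = true} e vs)  _         = tt
nonempty⁺ (_∷_ {b = false} e vs) (here e′) = contradiction (trans (sym e) e′) λ ()
nonempty⁺ (_∷_ {b = false} e vs) (there i) = nonempty⁺ vs i

nonempty⁻ : ∀ {i} {a : Vec ℚ i} {u x} → Values a u x → T (nonempty x) → Any (λ c → dot a c ≡ 1ℚ) u
nonempty⁻ (_∷_ {b = true} e vs)  _ = here e
nonempty⁻ (_∷_ {b = false} e vs) t = there (nonempty⁻ vs t)

comb-zero⁺ : ∀ {i} (a : Vec ℚ i) u → All (λ c → dot a c ≡ 0ℚ) u → comb a (rows u) ≡ 𝟘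
comb-zero⁺ a []      []       with comb a (rows [])
... | [] = refl
comb-zero⁺ a (c ∷ u) (e ∷ es) = trans (comb-zipWith-∷ a c (rows u)) (cong₂ _∷_ e (comb-zero⁺ a u es))

comb-zero⁻ : ∀ {i} (a : Vec ℚ i) u → comb a (rows u) ≡ 𝟘 → All (λ c → dot a c ≡ 0ℚ) u
comb-zero⁻ a []      _  = []
comb-zero⁻ a (c ∷ u) eq with trans (sym (comb-zipWith-∷ a c (rows u))) eq
... | eq′ = cong Vec.head eq′ ∷ comb-zero⁻ a u (cong Vec.tail eq′)

-- The values of a bad combination are 0 or 1 and so spell out a vector `x`; one value is 1, so `x`
-- is a hyperplane of the arrangement, and the support condition makes it broken.
Good⇒GoodColumns : ∀ {i} (u : List (Vec Bool i)) → Good (toList (rows u)) → GoodColumns u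
Good⇒GoodColumns u (r , nbc) =
  (λ a es → independent⇒trivial (rows u) ind a (comb-zero⁺ a u es)) , not-bad
  where
  ind = rank≡length⇒independent (normals (toList (rows u))) (trans r (sym (length-map normal (toList (rows u)))))
  not-bad : ∀ a → ¬ BadCombination u a
  not-bad a (bits , some-one , supp) with values bits
  ... | x , vs = All.lookup nbc (∈-resonance⁺ (nonempty⁺ vs some-one))
    (subst (Span _) (Values⇒comb vs)
      (comb⇒Span-filter (_≺? x) (rows u) a (λ j → Sum.map₂ (Less⇒≺ vs) (supp j))))

GoodColumns⇒Good : ∀ {i} (u : List (Vec Bool i)) → GoodColumns u → Good (toList (rows u))
GoodColumns⇒Good u (triv , not-bad) =
  trans (independent⇒rank≡length _ (trivial⇒independent (rows u) (λ a eq → triv a (comb-zero⁻ a u eq))))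
        (length-map normal (toList (rows u))) ,
  All.tabulate unbroken
  where
  unbroken : ∀ {y} → y ∈ resonance (length u) → ¬ Broken (toList (rows u)) y
  unbroken {y} i p with Span-filter⇒comb (_≺? y) (rows u) p
  ... | a , supp , eq = not-bad a
    (values-bits vs , nonempty⁻ vs (∈-resonance⁻ i) , λ j → Sum.map₂ (≺⇒Less vs) (supp j))
    where vs = comb⇒Values a u eq

-- Deletion of redundant columns

weight : ∀ i → List (Vec Bool i) → ℕ
weight i u = 𝟙 (good? (toList (rows u)))

weight-cong : ∀ {i} (u u′ : List (Vec Bool i)) → (GoodColumns u → GoodColumns u′) →
              (GoodColumns u′ → GoodColumns u) → weight i u ≡ weight i u′
weight-cong u u′ f g = 𝟙-cong (good? (toList (rows u))) (good? (toList (rows u′)))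
  (GoodColumns⇒Good u′ ∘ f ∘ Good⇒GoodColumns u) (GoodColumns⇒Good u ∘ g ∘ Good⇒GoodColumns u′)

∅ : ∀ {i} → Vec Bool i
∅ = replicate _ false

All-insert : ∀ {A : Set} {P : A → Set} p {c q} → P c → All P (p ++ q) → All P (p ++ c ∷ q)
All-insert p pc ps = All.++⁺ (All.++⁻ˡ p ps) (pc ∷ All.++⁻ʳ p ps)

All-remove : ∀ {A : Set} {P : A → Set} p {c q} → All P (p ++ c ∷ q) → All P (p ++ q)
All-remove p ps with All.++⁻ʳ p ps
... | _ ∷ qs = All.++⁺ (All.++⁻ˡ p ps) qs

Any-insert : ∀ {A : Set} {P : A → Set} p {c q} → Any P (p ++ q) → Any P (p ++ c ∷ q)
Any-insert p i with Any.++⁻ p i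
... | inj₁ j = Any.++⁺ˡ j
... | inj₂ j = Any.++⁺ʳ p (there j)

Any-remove : ∀ {A : Set} {P : A → Set} p {c q} → (P c → Any P p) → Any P (p ++ c ∷ q) → Any P (p ++ q)
Any-remove p f i with Any.++⁻ p i
... | inj₁ j         = Any.++⁺ˡ j
... | inj₂ (here pc) = Any.++⁺ˡ (f pc)
... | inj₂ (there j) = Any.++⁺ʳ p j

-- If the comparison is decided to the left of the inserted column, it stays as it is. Otherwise it
-- has passed an earlier copy of `c` with a tie, and the same tie recurs; a zero column is a tie for
-- every `a`.
Less-insert : ∀ {i} {j : Fin i} {a} p {c q} → dot a c ≡ ⟦ lookup c j ⟧ ⊎ c ∈ p →
              Less j a (p ++ q) → Less j a (p ++ c ∷ q)
Less-insert []      (inj₁ e)            l           = there e l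
Less-insert (d ∷ p) h                   (here f e)  = here f e
Less-insert (d ∷ p) (inj₁ e)            (there e′ l) = there e′ (Less-insert p (inj₁ e) l)
Less-insert (d ∷ p) (inj₂ (here refl))  (there e′ l) = there e′ (Less-insert p (inj₁ e′) l)
Less-insert (d ∷ p) (inj₂ (there c∈p))  (there e′ l) = there e′ (Less-insert p (inj₂ c∈p) l)

Less-remove : ∀ {i} {j : Fin i} {a} p {c q} → dot a c ≡ ⟦ lookup c j ⟧ ⊎ c ∈ p →
              Less j a (p ++ c ∷ q) → Less j a (p ++ q)
Less-remove []      (inj₁ e)            (here f e′)  =
  contradiction (trans (sym (trans e (cong ⟦_⟧ f))) e′) λ ()
Less-remove []      (inj₁ e)            (there _ l)  = l
Less-remove (d ∷ p) h                   (here f e)  = here f e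
Less-remove (d ∷ p) (inj₁ e)            (there e′ l) = there e′ (Less-remove p (inj₁ e) l)
Less-remove (d ∷ p) (inj₂ (here refl))  (there e′ l) = there e′ (Less-remove p (inj₁ e′) l)
Less-remove (d ∷ p) (inj₂ (there c∈p))  (there e′ l) = there e′ (Less-remove p (inj₂ c∈p) l)

weight-absorbs : ∀ i → Absorbs (∅ ∷ []) (weight i)
weight-absorbs i p {c} q seen = weight-cong (p ++ c ∷ q) (p ++ q)
  (λ { (triv , nb) → (λ a es → triv a (All-insert p (value a (_≡ 0ℚ) refl (All.++⁻ˡ p es)) es)) ,
       λ { a (bits , one , supp) → nb a
         ( All-insert p (value a IsBit (inj₁ refl) (All.++⁻ˡ p bits)) bits , Any-insert p one
         , λ j → Sum.map₂ (Less-insert p (agree a j)) (supp j)) } })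
  (λ { (triv , nb) → (λ a es → triv a (All-remove p es)) ,
       λ { a (bits , one , supp) → nb a
         ( All-remove p bits , Any-remove p (one-before a) one
         , λ j → Sum.map₂ (Less-remove p (agree a j)) (supp j)) } })
  where
  dot-c≡0 : ∀ a → c ∈ ∅ ∷ [] → dot a c ≡ 0ℚ
  dot-c≡0 a (here eq) = trans (cong (dot a) eq) (dot-empty a)
  value : ∀ a (P : ℚ → Set) → P 0ℚ → All (P ∘ dot a) p → P (dot a c)
  value a P p0 ps = Sum.[ (λ i → subst P (sym (dot-c≡0 a i)) p0) , All.lookup ps ] seen
  agree : ∀ a j → dot a c ≡ ⟦ lookup c j ⟧ ⊎ c ∈ p
  agree a j = Sum.map₁ (λ { i@(here eq) → trans (dot-c≡0 a i)
    (cong ⟦_⟧ (sym (trans (cong (λ v → lookup v j) eq) (Vec.lookup-replicate j false)))) }) seen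
  -- A zero column never takes the value 1, so a 1 lost by the deletion is still present at the
  -- earlier copy of `c`.
  one-before : ∀ a → dot a c ≡ 1ℚ → Any (λ c → dot a c ≡ 1ℚ) p
  one-before a e = Sum.[ (λ i → contradiction (trans (sym (dot-c≡0 a i)) e) λ ()) , (λ i → lose i e) ] seen

-- `i` independent rows need at least `i` columns; this is why the sum over k starts at i + 1.
weight-short : ∀ {i} (u : List (Vec Bool i)) → length u < i → weight i u ≡ 0
weight-short {i} u lt = 𝟙-no (good? (toList (rows u))) λ (r , _) →
  ℕ.<⇒≱ lt (subst (_≤ length u) (trans r (Vec.length-toList (rows u))) (rank≤dimension (normals (toList (rows u)))))

weight≤1 : ∀ {i} (u : List (Vec Bool i)) → weight i u ≤ 1
weight≤1 u = 𝟙≤1 (good? (toList (rows u)))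

-- The staircase 1⋯1, 01⋯1, …, 0⋯01 of columns.
stairs : ∀ i → List (Vec Bool i)
stairs zero    = []
stairs (suc i) = replicate (suc i) true ∷ map (false ∷_) (stairs i)

length-stairs : ∀ i → length (stairs i) ≡ i
length-stairs zero    = refl
length-stairs (suc i) = cong suc (trans (length-map _ (stairs i)) (length-stairs i))

stairs-unique : ∀ i → Unique (stairs i)
stairs-unique zero    = []
stairs-unique (suc i) = All.map⁺ (All.universal (λ _ ()) (stairs i)) ∷ Unique.map⁺ (cong Vec.tail) (stairs-unique i)

stairs-nonempty : ∀ i → All (_∉ ∅ ∷ []) (stairs i)
stairs-nonempty zero    = []
stairs-nonempty (suc i) = (λ { (here ()) }) ∷
  All.map⁺ (All.map (λ { c∉ (here eq) → c∉ (here (cong Vec.tail eq)) }) (stairs-nonempty i))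

-- The constructor `[]` admits a tie: a strict comparison along `stairs i ++ q` may be decided only
-- inside `q`.
data LessEq {i} (j : Fin i) (a : Vec ℚ i) : List (Vec Bool i) → Set where
  []    : LessEq j a []
  here  : ∀ {c u} → lookup c j ≡ false → dot a c ≡ 1ℚ → LessEq j a (c ∷ u)
  there : ∀ {c u} → dot a c ≡ ⟦ lookup c j ⟧ → LessEq j a u → LessEq j a (c ∷ u)

Less⇒LessEq : ∀ {i} {j : Fin i} {a} p {q} → Less j a (p ++ q) → LessEq j a p
Less⇒LessEq []      l           = []
Less⇒LessEq (c ∷ p) (here f e)  = here f e
Less⇒LessEq (c ∷ p) (there e l) = there e (Less⇒LessEq p l)

dot-0∷ : ∀ {i} (a : Vec ℚ i) b c → dot (0ℚ ∷ a) (b ∷ c) ≡ dot a c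
dot-0∷ a b c = trans (cong (ℚ._+ dot a c) (ℚ.*-zeroˡ ⟦ b ⟧)) (ℚ.+-identityˡ _)

dot-∷-false : ∀ {i} x (a : Vec ℚ i) c → dot (x ∷ a) (false ∷ c) ≡ dot a c
dot-∷-false x a c = trans (cong (ℚ._+ dot a c) (ℚ.*-zeroʳ x)) (ℚ.+-identityˡ _)

dot-∷-true : ∀ {i} x (a : Vec ℚ i) c → dot (x ∷ a) (true ∷ c) ≡ x ℚ.+ dot a c
dot-∷-true x a c = cong (ℚ._+ dot a c) (ℚ.*-identityʳ x)

-- All columns but the first start with 0 and force the tail of `a` to vanish by induction; the
-- first column then gives `x`.
stairs-independent : ∀ i a → All (λ c → dot a c ≡ 0ℚ) (stairs i) → a ≡ 𝟘
stairs-independent zero    []      []       = refl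
stairs-independent (suc i) (x ∷ a) (e ∷ es)
  with stairs-independent i a (All.map (trans (sym (dot-∷-false x a _))) (All.map⁻ es))
... | refl = cong (_∷ 𝟘) (trans (sym (ℚ.+-identityʳ x))
  (trans (cong (x ℚ.+_) (sym (dot-𝟘 (replicate i true)))) (trans (sym (dot-∷-true x 𝟘 (replicate i true))) e)))

IsUnit : ∀ {i} → Vec ℚ i → Set
IsUnit a = ∃ λ J → lookup a J ≢ 0ℚ × ∀ c → dot a c ≡ ⟦ lookup c J ⟧

-- If Σ_j a_j row_j ≥ row_j whenever a_j ≠ 0, then it begins with as many ones as the
-- largest such row, which forces a to be a unit vector.
stairs-unit : ∀ i (a : Vec ℚ i) → (∀ j → lookup a j ≡ 0ℚ ⊎ LessEq j a (stairs i)) → a ≡ 𝟘 ⊎ IsUnit a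
stairs-unit zero    []      _    = inj₁ refl
stairs-unit (suc i) (x ∷ a) supp with stairs-unit i a (λ j → Sum.map₂ (tail-≤ j) (supp (suc j)))
  where
  drop-false : ∀ {j} u → LessEq (suc j) (x ∷ a) (map (false ∷_) u) → LessEq j a u
  drop-false []      []          = []
  drop-false (c ∷ u) (here f e)  = here f (trans (sym (dot-∷-false x a c)) e)
  drop-false (c ∷ u) (there e l) = there (trans (sym (dot-∷-false x a c)) e) (drop-false u l)
  tail-≤ : ∀ j → LessEq (suc j) (x ∷ a) (stairs (suc i)) → LessEq j a (stairs i)
  -- Every row begins with 1, so no comparison is decided at the first column.
  tail-≤ j (here f _)  = contradiction (trans (sym f) (Vec.lookup-replicate j true)) λ ()
  tail-≤ j (there _ l) = drop-false (stairs i) l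
... | inj₁ refl with x ℚ.≟ 0ℚ | supp zero
...   | yes refl | _                  = inj₁ refl
...   | no x≢0   | inj₁ x≡0           = contradiction x≡0 x≢0
...   | no x≢0   | inj₂ (here () _)
-- With the tail of `a` zero, the tie at the first column reads x = 1.
...   | no x≢0   | inj₂ (there e _)   = inj₂ (zero , x≢0 , λ { (b ∷ c) → unit b c })
  where
  x≡1 : x ≡ 1ℚ
  x≡1 = trans (sym (ℚ.+-identityʳ x)) (trans (cong (x ℚ.+_) (sym (dot-𝟘 (replicate i true))))
          (trans (sym (dot-∷-true x 𝟘 (replicate i true))) e))
  unit : ∀ b c → dot (x ∷ 𝟘) (b ∷ c) ≡ ⟦ b ⟧
  unit b c = trans (cong₂ ℚ._+_ (trans (cong (ℚ._* ⟦ b ⟧) x≡1) (ℚ.*-identityˡ ⟦ b ⟧)) (dot-𝟘 c)) (ℚ.+-identityʳ ⟦ b ⟧)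
stairs-unit (suc i) (x ∷ a) supp | inj₂ (J , aJ≢0 , unit) with supp (suc J)
... | inj₁ aJ≡0       = contradiction aJ≡0 aJ≢0
... | inj₂ (here f _) = contradiction (trans (sym f) (Vec.lookup-replicate J true)) λ ()
-- The tail alone is row `J`, with value 1 on the all-ones column, so the tie at the first column
-- reads x + 1 = 1.
... | inj₂ (there e _) = inj₂ (suc J , aJ≢0 , λ { (b ∷ c) →
    trans (cong (λ z → dot (z ∷ a) (b ∷ c)) x≡0) (trans (dot-0∷ a b c) (unit c)) })
  where
  top : ⟦ lookup (replicate i true) J ⟧ ≡ 1ℚ
  top = cong ⟦_⟧ (Vec.lookup-replicate J true)
  x≡0 : x ≡ 0ℚ
  x≡0 = trans (solve 1 (λ x → x := (x :+ con 1ℚ) :- con 1ℚ) refl x)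
    (cong (ℚ._- 1ℚ) (trans (cong (x ℚ.+_) (sym (trans (unit (replicate i true)) top)))
      (trans (sym (dot-∷-true x a _)) (trans e top))))
    where open ℚ-Solver.+-*-Solver

Less-irrefl : ∀ {i} {j : Fin i} {a u} → (∀ c → dot a c ≡ ⟦ lookup c j ⟧) → ¬ Less j a u
Less-irrefl unit (here {c} f e) = contradiction (trans (sym (trans (unit c) (cong ⟦_⟧ f))) e) λ ()
Less-irrefl unit (there _ l)    = Less-irrefl unit l

-- A bad combination would be zero, hence without a value 1, or a single row, which would have to be
-- strictly smaller than itself.
weight-stairs : ∀ i q → 0 < weight i (stairs i ++ q)
weight-stairs i q = ℕ.≤-reflexive (sym (𝟙-yes (good? (toList (rows (stairs i ++ q))))
  (GoodColumns⇒Good (stairs i ++ q)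
    ((λ a es → stairs-independent i a (All.++⁻ˡ (stairs i) es)) , not-bad))))
  where
  not-bad : ∀ a → ¬ BadCombination (stairs i ++ q) a
  not-bad a (_ , one , supp) with stairs-unit i a (λ j → Sum.map₂ (Less⇒LessEq (stairs i)) (supp j))
  ... | inj₁ refl = let c , _ , e = find one in contradiction (trans (sym (dot-𝟘 c)) e) λ ()
  ... | inj₂ (J , aJ≢0 , unit) with supp J
  ...   | inj₁ aJ≡0 = aJ≢0 aJ≡0
  ...   | inj₂ l    = Less-irrefl unit l

-- The coefficients and the formula

infix 4 _≟ᶜ_

_≟ᶜ_ : ∀ {i} (c d : Vec Bool i) → Dec (c ≡ d)
_≟ᶜ_ = Vec.≡-dec Bool._≟_

allSubsets-once : ∀ i (d : Vec Bool i) → ∑ (allSubsets i) (λ c → 𝟙 (c ≟ᶜ d)) ≡ 1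
allSubsets-once zero    []      = refl
allSubsets-once (suc i) (b ∷ d) = trans (∑-allSubsets-suc i _) (split b)
  where
  same : ∀ b → ∑ (allSubsets i) (λ c → 𝟙 (b ∷ c ≟ᶜ b ∷ d)) ≡ 1
  same b = trans (∑-cong (λ c → 𝟙-cong (b ∷ c ≟ᶜ b ∷ d) (c ≟ᶜ d) (cong Vec.tail) (cong (b ∷_))) (allSubsets i))
                 (allSubsets-once i d)
  differ : ∀ b b′ → b ≢ b′ → ∑ (allSubsets i) (λ c → 𝟙 (b ∷ c ≟ᶜ b′ ∷ d)) ≡ 0
  differ b b′ b≢b′ = ∑-zero (λ c → 𝟙-no (b ∷ c ≟ᶜ b′ ∷ d) (b≢b′ ∘ cong Vec.head)) (allSubsets i)
  split : ∀ b → ∑ (allSubsets i) (λ c → 𝟙 (true ∷ c ≟ᶜ b ∷ d)) + ∑ (allSubsets i) (λ c → 𝟙 (false ∷ c ≟ᶜ b ∷ d)) ≡ 1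
  split true  = cong₂ _+_ (same true) (differ false true λ ())
  split false = cong₂ _+_ (differ true false λ ()) (same false)

length-allSubsets : ∀ i → length (allSubsets i) ≡ 2 ^ i
length-allSubsets zero    = refl
length-allSubsets (suc i) = trans (length-++ (map (true ∷_) (allSubsets i)))
  (cong₂ _+_ (trans (length-map _ (allSubsets i)) (length-allSubsets i))
    (trans (length-map _ (allSubsets i)) (trans (length-allSubsets i) (sym (ℕ.+-identityʳ _)))))

-- i! times the number of i-element nbc sets of A_m whose incidence matrix has
-- m distinct nonzero columns.
labelled : ℕ → ℕ → ℕ
labelled i m = ∑-fresh _≟ᶜ_ (allSubsets i) (allSubsets-once i) m (∅ ∷ []) (weight i)

∑-tuples-good : ∀ i n M → n < M →
  ∑-tuples i (allSubsets n) (𝟙 ∘ good? ∘ toList) ≡ ∑ (upTo M) (λ m → rStirling n 1 m * labelled i m)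
∑-tuples-good i n M n<M = trans (∑-tuples-transpose i n (λ _ R → 𝟙 (good? (toList R))))
  (∑-tuples-by-letters _≟ᶜ_ (allSubsets i) (allSubsets-once i) n M (∅ ∷ []) (weight i) n<M
    ([] ∷ []) (weight-absorbs i))

i!∣labelled : ∀ i m → i ! ∣ labelled i m
i!∣labelled i = ∣-unitriangular (λ n → rStirling n 1) (labelled i) (λ n → rStirling-diagonal n 1)
  λ n → subst (i ! ∣_)
    (trans (sym (∑-tuples≡i!*∑-choose i (allSubsets n) (𝟙 ∘ good?) 𝟙-good-↭ 𝟙-good-repeat))
           -- The choice `M = suc n` ends the sum at the diagonal entry.
           (∑-tuples-good i n (suc n) (ℕ.n<1+n n)))
    (m∣m*n _)

private
  allButEmpty : ∀ i → 2 ^ i ∸ 1 + 1 ≡ length (allSubsets i)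
  allButEmpty i = trans (ℕ.m∸n+n≡m (ℕ.m^n>0 2 i)) (sym (length-allSubsets i))

labelled-small : ∀ i m → m < i → labelled i m ≡ 0
labelled-small i m m<i = ∑-fresh-vanish _≟ᶜ_ (allSubsets i) (allSubsets-once i) m
  (λ u eq → weight-short u (subst (_< i) (sym eq) m<i))

labelled-large : ∀ i m → 2 ^ i ≤ m → labelled i m ≡ 0
labelled-large i m le = ∑-fresh-zero _≟ᶜ_ (allSubsets i) (allSubsets-once i) m ([] ∷ []) (allButEmpty i)
  (subst (_≤ m) (sym (trans (ℕ.+-comm 1 _) (ℕ.m∸n+n≡m (ℕ.m^n>0 2 i)))) le)

labelled-positive : ∀ i m → i ≤ m → m < 2 ^ i → 0 < labelled i m
labelled-positive i m i≤m m<2^i = subst (λ k → 0 < labelled i k)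
  (trans (cong (_+ (m ∸ i)) (length-stairs i)) (ℕ.m+[n∸m]≡n i≤m))
  (∑-fresh-positive _≟ᶜ_ (allSubsets i) (allSubsets-once i) (stairs i) (m ∸ i) ([] ∷ [])
    (stairs-unique i) (stairs-nonempty i)
    -- The summand 1 is the zero column, so what is needed is `suc m ≤ 2 ^ i`.
    (subst (_≤ length (allSubsets i)) (sym (trans (cong (λ l → l + (m ∸ i) + 1) (length-stairs i))
       (trans (cong (_+ 1) (ℕ.m+[n∸m]≡n i≤m)) (ℕ.+-comm m 1))))
       (subst (suc m ≤_) (sym (length-allSubsets i)) m<2^i))
    (weight-stairs i))

nCk*k![n∸k]!≡n! : ∀ {n k} → k ≤ n → (n C k) * (k ! * (n ∸ k) !) ≡ n !
nCk*k![n∸k]!≡n! {n} {k} k≤n = trans (cong (_* (k ! * (n ∸ k) !)) (nCk≡n!/k![n-k]! k≤n))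
  (m/n*n≡m {{k ℕ.!* (n ∸ k) !≢0}} (subst (_∣ n !) (ℕ.*-comm ((n ∸ k) !) (k !)) ([n∸k]!k!∣n! k≤n)))

labelled-≤ : ∀ i m → m < 2 ^ i → labelled i m ≤ ((2 ^ i ∸ 1) C m) * m !
labelled-≤ i m m<2^i = ℕ.*-cancelʳ-≤ _ _ ((N ∸ m) !) {{(N ∸ m) ℕ.!≢0}} (begin
  labelled i m * (N ∸ m) !
    ≤⟨ ∑-fresh-≤ _≟ᶜ_ (allSubsets i) (allSubsets-once i) m ([] ∷ []) (allButEmpty i) m≤N weight≤1 ⟩
  N !
    ≡⟨ nCk*k![n∸k]!≡n! m≤N ⟨
  (N C m) * (m ! * (N ∸ m) !)
    ≡⟨ ℕ.*-assoc (N C m) (m !) _ ⟨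
  (N C m) * m ! * (N ∸ m) ! ∎)
  where
  open ℕ.≤-Reasoning
  N = 2 ^ i ∸ 1
  m≤N : m ≤ N
  m≤N = ℕ.∸-monoˡ-≤ 1 m<2^i

coefficient : ℕ → ℕ → ℕ
coefficient i k = quotient (i!∣labelled i (k ∸ 1))

coefficient-*-i! : ∀ i k → coefficient i k * i ! ≡ labelled i (k ∸ 1)
coefficient-*-i! i k = sym (_∣_.equality (i!∣labelled i (k ∸ 1)))

coefficient-positive : ∀ i k → suc i ≤ k → k ≤ 2 ^ i → 0 < coefficient i k
coefficient-positive i (suc m) (s≤s i≤m) m<2^i = ℕ.n≢0⇒n>0 λ c≡0 →
  ℕ.<⇒≢ (labelled-positive i m i≤m m<2^i)
    (trans (cong (_* i !) (sym c≡0)) (coefficient-*-i! i (suc m)))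

coefficient-≤ : ∀ i k → suc i ≤ k → k ≤ 2 ^ i →
  coefficient i k * (i !) ≤ ((2 ^ i ∸ 1) C (k ∸ 1)) * ((k ∸ 1) !)
coefficient-≤ i (suc m) (s≤s i≤m) m<2^i =
  subst (_≤ ((2 ^ i ∸ 1) C m) * m !) (sym (coefficient-*-i! i (suc m))) (labelled-≤ i m m<2^i)

i≤2^i : ∀ i → i ≤ 2 ^ i
i≤2^i zero    = z≤n
i≤2^i (suc i) = ℕ.≤-trans (ℕ.+-mono-≤ (ℕ.m^n>0 2 i) (i≤2^i i)) (ℕ.+-monoʳ-≤ (2 ^ i) (ℕ.m≤m+n (2 ^ i) 0))

-- The upper limit is 2^i + n + 1: it exceeds `n`, as `∑-tuples-good` demands, and is written so
-- that it splits at i and at 2^i. The two outer ranges vanish by `labelled-small` and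
-- `labelled-large`.
∑-labelled-range : ∀ i n →
  ∑ (upTo (i + (2 ^ i ∸ i + suc n))) (λ m → rStirling n 1 m * labelled i m) ≡
  i ! * sumFromTo (suc i) (2 ^ i) (λ k → coefficient i k * stirling2 (suc n) k)
∑-labelled-range i n = begin
  ∑ (upTo (i + (2 ^ i ∸ i + suc n))) F
    ≡⟨ ∑-upTo-+ i (2 ^ i ∸ i + suc n) F ⟩
  ∑ (upTo i) F + ∑ (upTo (2 ^ i ∸ i + suc n)) (λ j → F (i + j))
    ≡⟨ cong₂ _+_ (∑-upTo-zero i (λ m m<i → vanish m (labelled-small i m m<i)))
                 (∑-upTo-+ (2 ^ i ∸ i) (suc n) (λ j → F (i + j))) ⟩
  ∑ (upTo (2 ^ i ∸ i)) (λ j → F (i + j)) + ∑ (upTo (suc n)) (λ j → F (i + (2 ^ i ∸ i + j)))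
    ≡⟨ cong₂ _+_ (∑-cong term (upTo (2 ^ i ∸ i)))
                 (∑-zero (λ j → vanish _ (labelled-large i _ (large j))) (upTo (suc n))) ⟩
  ∑ (upTo (2 ^ i ∸ i)) (λ j → i ! * (coefficient i (suc i + j) * stirling2 (suc n) (suc i + j))) + 0
    ≡⟨ ℕ.+-identityʳ _ ⟩
  ∑ (upTo (2 ^ i ∸ i)) (λ j → i ! * (coefficient i (suc i + j) * stirling2 (suc n) (suc i + j)))
    ≡⟨ ∑-*ˡ (i !) (upTo (2 ^ i ∸ i)) _ ⟩
  i ! * sumFromTo (suc i) (2 ^ i) (λ k → coefficient i k * stirling2 (suc n) k) ∎
  where
  open ≡-Reasoning
  F : ℕ → ℕ
  F m = rStirling n 1 m * labelled i m
  vanish : ∀ m → labelled i m ≡ 0 → F m ≡ 0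
  vanish m eq = trans (cong (rStirling n 1 m *_) eq) (ℕ.*-zeroʳ (rStirling n 1 m))
  large : ∀ j → 2 ^ i ≤ i + (2 ^ i ∸ i + j)
  large j = subst (_≤ i + (2 ^ i ∸ i + j)) (ℕ.m+[n∸m]≡n (i≤2^i i)) (ℕ.+-monoʳ-≤ i (ℕ.m≤m+n (2 ^ i ∸ i) j))
  term : ∀ j → F (i + j) ≡ i ! * (coefficient i (suc i + j) * stirling2 (suc n) (suc i + j))
  term j = trans (cong₂ _*_ (rStirling≡stirling2 n (i + j)) (sym (coefficient-*-i! i (suc i + j))))
    (trans (ℕ.*-comm _ (coefficient i (suc i + j) * i !))
    (trans (cong (_* stirling2 (suc n) (suc i + j)) (ℕ.*-comm (coefficient i (suc i + j)) (i !)))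
           (ℕ.*-assoc (i !) _ _)))

betti-formula : ∀ n (rk : List (Vec Bool n) → ℕ) → IsRankFn n rk → ∀ i →
  betti n rk i ≡ sumFromTo (suc i) (2 ^ i) (λ k → coefficient i k * stirling2 (suc n) k)
betti-formula n rk isRank i = ℕ.*-cancelˡ-≡ _ _ (i !) {{i ℕ.!≢0}} (begin
  i ! * betti n rk i
    ≡⟨ ∑-tuples≡i!*betti n rk isRank i ⟨
  ∑-tuples i (allSubsets n) _
    ≡⟨ ∑-tuples-good i n (i + (2 ^ i ∸ i + suc n)) (ℕ.≤-trans (ℕ.m≤n+m (suc n) (2 ^ i ∸ i)) (ℕ.m≤n+m _ i)) ⟩
  ∑ (upTo (i + (2 ^ i ∸ i + suc n))) (λ m → rStirling n 1 m * labelled i m)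
    ≡⟨ ∑-labelled-range i n ⟩
  i ! * sumFromTo (suc i) (2 ^ i) (λ k → coefficient i k * stirling2 (suc n) k) ∎)
  where open ≡-Reasoning

theorem1p4 : Σ (ℕ → ℕ → ℕ) λ c →
    (∀ i k → suc i ≤ k → k ≤ 2 ^ i → 0 < c i k) ×
    (∀ i k → suc i ≤ k → k ≤ 2 ^ i →
    c i k * (i !) ≤ ((2 ^ i ∸ 1) C (k ∸ 1)) * ((k ∸ 1) !)) ×
    (∀ n → 1 ≤ n → (rk : List (Vec Bool n) → ℕ) → IsRankFn n rk →
    ∀ i → betti n rk i ≡ sumFromTo (suc i) (2 ^ i) (λ k → c i k * stirling2 (suc n) k))
theorem1p4 = coefficient , coefficient-positive , coefficient-≤ ,
  λ n _ rk isRank i → betti-formula n rk isRank i
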